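{- A matrix $A\in\mathbb{Q}^{m\times n}$ is totally equimodular if and only if the polyhedron $\{x\in\mathbb{R}^n:Ax\le b\}$ is principally box-integer for all $b\in\mathbb{Q}^m$.
   Context: A rational $r\times n$ matrix is equimodular if it has full row rank (rank $r$) and all its nonzero $r\times r$ determinants have the same absolute value. A rational matrix is totally equimodular if every set of linearly independent rows of it forms an equimodular matrix. A polyhedron is a set $P=\{x\in\mathbb{R}^n: Mx\le d\}$ with $M,d$ rational. A face of $P$ is a nonempty set obtained from $P$ by imposing equality in some (possibly none) of the inequalities. $P$ is integer if each of its faces contains a point of $\mathbb{Z}^n$. $P$ is box-integer if $P\cap\{x:\ell\le x\le u\}$ is integer for all $\ell,u\in\mathbb{Z}^n$. For a positive integer $k$, $kP=\{kx:x\in P\}$. $P$ is principally box-integer if $kP$ is box-integer for every positive integer $k$ such that $kP$ is integer. -}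

module Defs where

open import Algebra.Bundles using (CommutativeRing)
open import Data.Bool.Base using (if_then_else_)
open import Data.Fin.Base as Fin using (Fin; zero; suc; toℕ; punchIn; splitAt; _↑ˡ_; _↑ʳ_)
import Data.Fin.Properties as Fin
open import Data.Fin.Subset using (Subset) renaming (_∈_ to _∈ₛ_)
open import Data.Integer.Base as ℤ using (ℤ)
open import Data.Nat.Base as ℕ using (ℕ; zero; suc)
import Data.Nat.Properties as ℕ
open import Data.Product.Base using (∃; _×_; _,_; proj₁; proj₂)
open import Data.Rational.Base
open import Data.Rational.Properties
open import Data.Rational.Solver using (module +-*-Solver)
open import Data.Sum.Base using (inj₁; inj₂)
open import Data.Vec.Functional using (Vector; foldr; _++_)
open import Data.Vec.Functional.Properties using (lookup-++ˡ; lookup-++ʳ)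
open import Function.Base using (_∘_)
open import Level using (0ℓ)
open import Relation.Binary.PropositionalEquality
open import Relation.Nullary.Decidable.Core using (does)
open import Relation.Unary using (Pred; _∈_; _∩_; _≐_; Satisfiable)

open import Algebra.Properties.Semiring.Sum (CommutativeRing.semiring +-*-commutativeRing)
  using (sum; sum-cong-≗; *-distribˡ-sum)

------------------------------------------------------------------------
-- Rational matrices

Matrix : ℕ → ℕ → Set
Matrix m n = Vector (Vector ℚ n) m

sign : ℕ → ℚ
sign zero    = 1ℚ
sign (suc k) = - sign k

-- Laplace expansion along the first row.
det : ∀ {r} → Matrix r r → ℚ
det {zero}  M = 1ℚ
det {suc r} M = sum λ j → sign (toℕ j) * M zero j * det (λ i k → M (suc i) (punchIn j k))

-- A set of r indices out of n, listed in increasing order.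
record Selection (r n : ℕ) : Set where
  field
    index      : Fin r → Fin n
    increasing : ∀ {i j} → i Fin.< j → index i Fin.< index j

open Selection public

selectRows : ∀ {r m n} → Matrix m n → Selection r m → Matrix r n
selectRows M R i = M (index R i)

selectColumns : ∀ {r m n} → Matrix m n → Selection r n → Matrix m r
selectColumns M C i k = M i (index C k)

LinearlyIndependent : ∀ {r n} → Vector (Vector ℚ n) r → Set
LinearlyIndependent {r} v =
  ∀ (c : Vector ℚ r) → (∀ j → sum (λ i → c i * v i j) ≡ 0ℚ) → ∀ i → c i ≡ 0ℚ

-- An r × n matrix has rank r exactly when no rational combination of its
-- r rows vanishes nontrivially.
FullRowRank : ∀ {r n} → Matrix r n → Set
FullRowRank M = LinearlyIndependent M

Equimodular : ∀ {r n} → Matrix r n → Set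
Equimodular {r} {n} M =
  FullRowRank M ×
  (∀ (C D : Selection r n) →
   det (selectColumns M C) ≢ 0ℚ → det (selectColumns M D) ≢ 0ℚ →
   ∣ det (selectColumns M C) ∣ ≡ ∣ det (selectColumns M D) ∣)

TotallyEquimodular : ∀ {m n} → Matrix m n → Set
TotallyEquimodular {m} A =
  ∀ {r} (R : Selection r m) → LinearlyIndependent (selectRows A R) → Equimodular (selectRows A R)

------------------------------------------------------------------------
-- Real numbers: Cauchy sequences of rationals, with equality up to null
-- sequences.  Only the ordered ℚ-vector space structure is defined, as
-- all the linear forms below have rational coefficients.

private
  *-pos : ∀ {p q} → 0ℚ < p → 0ℚ < q → 0ℚ < p * q
  *-pos {p} 0<p 0<q = subst (_< p * _) (*-zeroʳ p) (*-monoʳ-<-pos p {{positive 0<p}} 0<q)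

  half-pos : ∀ {ε} → 0ℚ < ε → 0ℚ < ½ * ε
  half-pos = *-pos (positive⁻¹ ½)

  +-close : ∀ x x′ y y′ ε → ∣ x - x′ ∣ < ½ * ε → ∣ y - y′ ∣ < ½ * ε → ∣ (x + y) - (x′ + y′) ∣ < ε
  +-close x x′ y y′ ε hx hy = begin-strict
    ∣ (x + y) - (x′ + y′) ∣    ≡⟨ cong ∣_∣ (+-sub x x′ y y′) ⟩
    ∣ (x - x′) + (y - y′) ∣    ≤⟨ ∣p+q∣≤∣p∣+∣q∣ (x - x′) (y - y′) ⟩
    ∣ x - x′ ∣ + ∣ y - y′ ∣    <⟨ +-mono-< hx hy ⟩
    ½ * ε + ½ * ε              ≡⟨ *-distribʳ-+ ε ½ ½ ⟨
    1ℚ * ε                     ≡⟨ *-identityˡ ε ⟩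
    ε                          ∎
    where
    open ≤-Reasoning
    +-sub : ∀ x x′ y y′ → (x + y) - (x′ + y′) ≡ (x - x′) + (y - y′)
    +-sub = solve 4 (λ x x′ y y′ → (x :+ y) :- (x′ :+ y′) := (x :- x′) :+ (y :- y′)) refl
      where open +-*-Solver

  ∣a∣+1 : ℚ → ℚ
  ∣a∣+1 a = ∣ a ∣ + 1ℚ

  ∣a∣+1>0 : ∀ a → Positive (∣a∣+1 a)
  ∣a∣+1>0 a = positive (+-mono-≤-< (0≤∣p∣ a) (positive⁻¹ 1ℚ))

  shrink : ℚ → ℚ → ℚ
  shrink a ε = (1/ ∣a∣+1 a) {{pos⇒nonZero (∣a∣+1 a) {{∣a∣+1>0 a}}}} * ε

  shrink-pos : ∀ a {ε} → 0ℚ < ε → 0ℚ < shrink a ε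
  shrink-pos a = *-pos (positive⁻¹ ((1/ ∣a∣+1 a) {{pos⇒nonZero (∣a∣+1 a) {{∣a∣+1>0 a}}}})
                                   {{1/pos⇒pos (∣a∣+1 a) {{∣a∣+1>0 a}}}})

  *-close : ∀ a x x′ ε → ∣ x - x′ ∣ < shrink a ε → ∣ a * x - a * x′ ∣ < ε
  *-close a x x′ ε h = begin-strict
    ∣ a * x - a * x′ ∣    ≡⟨ cong ∣_∣ (*-sub a x x′) ⟩
    ∣ a * (x - x′) ∣      ≡⟨ ∣p*q∣≡∣p∣*∣q∣ a (x - x′) ⟩
    ∣ a ∣ * ∣ x - x′ ∣    ≤⟨ *-monoʳ-≤-nonNeg ∣ x - x′ ∣ {{∣-∣-nonNeg (x - x′)}} ∣a∣≤c ⟩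
    c * ∣ x - x′ ∣        <⟨ *-monoʳ-<-pos c {{∣a∣+1>0 a}} h ⟩
    c * (1/ c * ε)        ≡⟨ *-assoc c (1/ c) ε ⟨
    c * 1/ c * ε          ≡⟨ cong (_* ε) (*-inverseʳ c) ⟩
    1ℚ * ε                ≡⟨ *-identityˡ ε ⟩
    ε                     ∎
    where
    open ≤-Reasoning
    c : ℚ
    c = ∣a∣+1 a
    instance
      c-nonZero : NonZero c
      c-nonZero = pos⇒nonZero c {{∣a∣+1>0 a}}
    ∣a∣≤c : ∣ a ∣ ≤ c
    ∣a∣≤c = subst (_≤ c) (+-identityʳ ∣ a ∣) (+-monoʳ-≤ ∣ a ∣ (<⇒≤ (positive⁻¹ 1ℚ)))
    *-sub : ∀ a x y → a * x - a * y ≡ a * (x - y)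
    *-sub = solve 3 (λ a x y → a :* x :- a :* y := a :* (x :- y)) refl
      where open +-*-Solver

IsCauchy : (ℕ → ℚ) → Set
IsCauchy s = ∀ ε → 0ℚ < ε → ∃ λ N → ∀ p q → N ℕ.≤ p → N ℕ.≤ q → ∣ s p - s q ∣ < ε

record ℝ : Set where
  no-eta-equality
  field
    seq    : ℕ → ℚ
    cauchy : IsCauchy seq

open ℝ public

infix 4 _≈ℝ_ _≤ℝ_

_≈ℝ_ : ℝ → ℝ → Set
x ≈ℝ y = ∀ ε → 0ℚ < ε → ∃ λ N → ∀ n → N ℕ.≤ n → ∣ seq x n - seq y n ∣ < ε

_≤ℝ_ : ℝ → ℝ → Set
x ≤ℝ y = ∀ ε → 0ℚ < ε → ∃ λ N → ∀ n → N ℕ.≤ n → seq x n ≤ seq y n + ε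

fromℚ : ℚ → ℝ
fromℚ q .seq _ = q
fromℚ q .cauchy ε 0<ε = 0 , λ _ _ _ _ → subst (λ t → ∣ t ∣ < ε) (sym (+-inverseʳ q)) 0<ε

fromℤ : ℤ → ℝ
fromℤ z = fromℚ (z / 1)

infixl 6 _+ℝ_
infixr 7 _·ℝ_

_+ℝ_ : ℝ → ℝ → ℝ
(x +ℝ y) .seq n = seq x n + seq y n
(x +ℝ y) .cauchy ε 0<ε
  with N , hx ← cauchy x (½ * ε) (half-pos 0<ε)
     | M , hy ← cauchy y (½ * ε) (half-pos 0<ε) = N ℕ.⊔ M , λ p q ≤p ≤q →
  +-close (seq x p) (seq x q) (seq y p) (seq y q) ε
    (hx p q (ℕ.m⊔n≤o⇒m≤o N M ≤p) (ℕ.m⊔n≤o⇒m≤o N M ≤q))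
    (hy p q (ℕ.m⊔n≤o⇒n≤o N M ≤p) (ℕ.m⊔n≤o⇒n≤o N M ≤q))

_·ℝ_ : ℚ → ℝ → ℝ
(a ·ℝ x) .seq n = a * seq x n
(a ·ℝ x) .cauchy ε 0<ε = proj₁ h , λ p q ≤p ≤q →
  *-close a (seq x p) (seq x q) ε (proj₂ h p q ≤p ≤q)
  where
  h : ∃ λ N → ∀ p q → N ℕ.≤ p → N ℕ.≤ q → ∣ seq x p - seq x q ∣ < shrink a ε
  h = cauchy x (shrink a ε) (shrink-pos a 0<ε)

infix 8 _∙_

_∙_ : ∀ {n} → Vector ℚ n → Vector ℝ n → ℝ
a ∙ x = foldr _+ℝ_ (fromℚ 0ℚ) (λ j → a j ·ℝ x j)

------------------------------------------------------------------------
-- Polyhedra, given by a rational system Mx ≤ d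

record Polyhedron (n : ℕ) : Set where
  constructor polyhedron
  field
    {rows} : ℕ
    matrix : Matrix rows n
    rhs    : Vector ℚ rows

open Polyhedron public

⟦_⟧ : ∀ {n} → Polyhedron n → Pred (Vector ℝ n) 0ℓ
⟦ P ⟧ x = ∀ i → matrix P i ∙ x ≤ℝ fromℚ (rhs P i)

-- The points of P satisfying the inequalities in S with equality; this is
-- a face of P when it is nonempty.
tight : ∀ {n} (P : Polyhedron n) → Subset (rows P) → Pred (Vector ℝ n) 0ℓ
tight P S x = x ∈ ⟦ P ⟧ × (∀ i → i ∈ₛ S → matrix P i ∙ x ≈ℝ fromℚ (rhs P i))

IsInteger : ∀ {n} → Polyhedron n → Set
IsInteger {n} P =
  ∀ S → Satisfiable (tight P S) → ∃ λ (z : Vector ℤ n) → (fromℤ ∘ z) ∈ tight P S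

infixr 7 _⊓ᴾ_

-- Intersection: the two systems are concatenated.
_⊓ᴾ_ : ∀ {n} → Polyhedron n → Polyhedron n → Polyhedron n
P ⊓ᴾ Q = polyhedron (matrix P ++ matrix Q) (rhs P ++ rhs Q)

identity : ∀ {n} → Matrix n n
identity i j = if does (i Fin.≟ j) then 1ℚ else 0ℚ

-- x ≤ u and -x ≤ -ℓ
box : ∀ {n} → Vector ℤ n → Vector ℤ n → Polyhedron n
box ℓ u = polyhedron (identity ++ λ i j → - identity i j)
                     ((λ i → u i / 1) ++ (λ i → - (ℓ i / 1)))

IsBoxInteger : ∀ {n} → Polyhedron n → Set
IsBoxInteger {n} P = ∀ (ℓ u : Vector ℤ n) → IsInteger (P ⊓ᴾ box ℓ u)

-- kP, for k positive: Mx ≤ d becomes Mx ≤ kd; see dilate-correct.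
dilate : ∀ {n} → ℕ → Polyhedron n → Polyhedron n
dilate k P = polyhedron (matrix P) (λ i → ℤ.+ k / 1 * rhs P i)

IsPrincipallyBoxInteger : ∀ {n} → Polyhedron n → Set
IsPrincipallyBoxInteger P =
  ∀ (k : ℕ) .{{_ : ℕ.NonZero k}} → IsInteger (dilate k P) → IsBoxInteger (dilate k P)

------------------------------------------------------------------------
-- _⊓ᴾ_, box and dilate define the intended subsets of ℝⁿ.

seq-∙ : ∀ {n} (a : Vector ℚ n) (x : Vector ℝ n) p → seq (a ∙ x) p ≡ sum (λ j → a j * seq (x j) p)
seq-∙ {zero}  a x p = refl
seq-∙ {suc n} a x p = cong ((a zero * seq (x zero) p) +_) (seq-∙ (a ∘ suc) (x ∘ suc) p)

sum-identity : ∀ {n} (i : Fin n) (y : Vector ℚ n) → sum (λ j → identity i j * y j) ≡ y i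
sum-identity zero y = trans
  (cong₂ _+_ (*-identityˡ (y zero)) (sum-zero (y ∘ suc)))
  (+-identityʳ (y zero))
  where
  sum-zero : ∀ {n} (y : Vector ℚ n) → sum (λ j → 0ℚ * y j) ≡ 0ℚ
  sum-zero y = trans (sym (*-distribˡ-sum 0ℚ y)) (*-zeroˡ (sum y))
sum-identity (suc i) y = trans
  (cong₂ _+_ (*-zeroˡ (y zero)) (sum-identity i (y ∘ suc)))
  (+-identityˡ (y (suc i)))

seq-identity : ∀ {n} i (x : Vector ℝ n) p → seq (identity i ∙ x) p ≡ seq (x i) p
seq-identity i x p = trans (seq-∙ (identity i) x p) (sum-identity i (λ j → seq (x j) p))

seq-scale : ∀ {n} (c : ℚ) (a : Vector ℚ n) (x : Vector ℝ n) p →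
            seq (a ∙ (λ j → c ·ℝ x j)) p ≡ c * seq (a ∙ x) p
seq-scale c a x p = begin
  seq (a ∙ (λ j → c ·ℝ x j)) p            ≡⟨ seq-∙ a (λ j → c ·ℝ x j) p ⟩
  sum (λ j → a j * (c * seq (x j) p))     ≡⟨ sum-cong-≗ (λ j → swap (a j) c (seq (x j) p)) ⟩
  sum (λ j → c * (a j * seq (x j) p))     ≡⟨ *-distribˡ-sum c (λ j → a j * seq (x j) p) ⟨
  c * sum (λ j → a j * seq (x j) p)       ≡⟨ cong (c *_) (seq-∙ a x p) ⟨
  c * seq (a ∙ x) p                       ∎
  where
  open ≡-Reasoning
  swap : ∀ a c y → a * (c * y) ≡ c * (a * y)
  swap = solve 3 (λ a c y → a :* (c :* y) := c :* (a :* y)) refl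
    where open +-*-Solver

seq-negate : ∀ {n} (a : Vector ℚ n) (x : Vector ℝ n) p →
             seq ((λ j → - a j) ∙ x) p ≡ - seq (a ∙ x) p
seq-negate a x p = begin
  seq ((λ j → - a j) ∙ x) p                 ≡⟨ seq-∙ (λ j → - a j) x p ⟩
  sum (λ j → - a j * seq (x j) p)           ≡⟨ sum-cong-≗ (λ j → neg-* (a j) (seq (x j) p)) ⟩
  sum (λ j → - 1ℚ * (a j * seq (x j) p))    ≡⟨ *-distribˡ-sum (- 1ℚ) (λ j → a j * seq (x j) p) ⟨
  - 1ℚ * sum (λ j → a j * seq (x j) p)      ≡⟨ cong (- 1ℚ *_) (seq-∙ a x p) ⟨
  - 1ℚ * seq (a ∙ x) p                      ≡⟨ neg-1 (seq (a ∙ x) p) ⟩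
  - seq (a ∙ x) p                           ∎
  where
  open ≡-Reasoning
  neg-* : ∀ a y → - a * y ≡ - 1ℚ * (a * y)
  neg-* = solve 2 (λ a y → :- a :* y := :- con 1ℚ :* (a :* y)) refl
    where open +-*-Solver
  neg-1 : ∀ y → - 1ℚ * y ≡ - y
  neg-1 = solve 1 (λ y → :- con 1ℚ :* y := :- y) refl
    where open +-*-Solver

≤ℝ-respˡ : ∀ {x x′ y} → (∀ p → seq x p ≡ seq x′ p) → x ≤ℝ y → x′ ≤ℝ y
≤ℝ-respˡ {y = y} x≗x′ x≤y ε 0<ε with N , h ← x≤y ε 0<ε =
  N , λ n N≤n → subst (_≤ seq y n + ε) (x≗x′ n) (h n N≤n)

+ℝ-cong : ∀ x x′ y y′ → x ≈ℝ x′ → y ≈ℝ y′ → x +ℝ y ≈ℝ x′ +ℝ y′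
+ℝ-cong x x′ y y′ x≈x′ y≈y′ ε 0<ε
  with N , hx ← x≈x′ (½ * ε) (half-pos 0<ε)
     | M , hy ← y≈y′ (½ * ε) (half-pos 0<ε) = N ℕ.⊔ M , λ n ≤n →
  +-close (seq x n) (seq x′ n) (seq y n) (seq y′ n) ε
    (hx n (ℕ.m⊔n≤o⇒m≤o N M ≤n)) (hy n (ℕ.m⊔n≤o⇒n≤o N M ≤n))

·ℝ-cong : ∀ a x x′ → x ≈ℝ x′ → a ·ℝ x ≈ℝ a ·ℝ x′
·ℝ-cong a x x′ x≈x′ ε 0<ε = proj₁ h , λ n ≤n → *-close a (seq x n) (seq x′ n) ε (proj₂ h n ≤n)
  where
  h : ∃ λ N → ∀ n → N ℕ.≤ n → ∣ seq x n - seq x′ n ∣ < shrink a ε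
  h = x≈x′ (shrink a ε) (shrink-pos a 0<ε)

∙-cong : ∀ {n} (a : Vector ℚ n) (x x′ : Vector ℝ n) → (∀ j → x j ≈ℝ x′ j) → a ∙ x ≈ℝ a ∙ x′
∙-cong {zero}  a x x′ x≈x′ ε 0<ε = 0 , λ _ _ → 0<ε
∙-cong {suc n} a x x′ x≈x′ =
  +ℝ-cong (a zero ·ℝ x zero) (a zero ·ℝ x′ zero) ((a ∘ suc) ∙ (x ∘ suc)) ((a ∘ suc) ∙ (x′ ∘ suc))
    (·ℝ-cong (a zero) (x zero) (x′ zero) (x≈x′ zero))
    (∙-cong (a ∘ suc) (x ∘ suc) (x′ ∘ suc) (x≈x′ ∘ suc))

≈ℝ-≤ℝ-trans : ∀ x y z → x ≈ℝ y → y ≤ℝ z → x ≤ℝ z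
≈ℝ-≤ℝ-trans x y z x≈y y≤z ε 0<ε
  with N , h ← x≈y (½ * ε) (half-pos 0<ε)
     | M , k ← y≤z (½ * ε) (half-pos 0<ε) = N ℕ.⊔ M , λ n ≤n →
  begin
    seq x n                        ≡⟨ split (seq x n) (seq y n) ⟩
    (seq x n - seq y n) + seq y n  ≤⟨ +-mono-≤ (≤-trans (p≤∣p∣ (seq x n - seq y n))
                                                (<⇒≤ (h n (ℕ.m⊔n≤o⇒m≤o N M ≤n))))
                                      (k n (ℕ.m⊔n≤o⇒n≤o N M ≤n)) ⟩
    ½ * ε + (seq z n + ½ * ε)      ≡⟨ merge ε (seq z n) ⟩
    seq z n + ε                    ∎
  where
  open ≤-Reasoning
  open +-*-Solver
  split : ∀ s t → s ≡ (s - t) + t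
  split = solve 2 (λ s t → s := (s :- t) :+ t) refl
  merge : ∀ ε t → ½ * ε + (t + ½ * ε) ≡ t + ε
  merge = solve 2 (λ ε t → con ½ :* ε :+ (t :+ con ½ :* ε) := t :+ ε) refl
  p≤∣p∣ : ∀ p → p ≤ ∣ p ∣
  p≤∣p∣ p with ≤-total 0ℚ p
  ... | inj₁ 0≤p = ≤-reflexive (sym (0≤p⇒∣p∣≡p 0≤p))
  ... | inj₂ p≤0 = ≤-trans p≤0 (0≤∣p∣ p)

⊓ᴾ-correct : ∀ {n} (P Q : Polyhedron n) → ⟦ P ⊓ᴾ Q ⟧ ≐ ⟦ P ⟧ ∩ ⟦ Q ⟧
⊓ᴾ-correct {n} P Q = to , from
  where
  to : ∀ {x} → x ∈ ⟦ P ⊓ᴾ Q ⟧ → x ∈ ⟦ P ⟧ ∩ ⟦ Q ⟧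
  to {x} h =
    (λ i → subst₂ (λ a b → a ∙ x ≤ℝ fromℚ b)
      (lookup-++ˡ (matrix P) (matrix Q) i) (lookup-++ˡ (rhs P) (rhs Q) i) (h (i ↑ˡ rows Q))) ,
    (λ i → subst₂ (λ a b → a ∙ x ≤ℝ fromℚ b)
      (lookup-++ʳ (matrix P) (matrix Q) i) (lookup-++ʳ (rhs P) (rhs Q) i) (h (rows P ↑ʳ i)))

  from : ∀ {x} → x ∈ ⟦ P ⟧ ∩ ⟦ Q ⟧ → x ∈ ⟦ P ⊓ᴾ Q ⟧
  from (hP , hQ) i with splitAt (rows P) i
  ... | inj₁ j = hP j
  ... | inj₂ j = hQ j

box-correct : ∀ {n} (ℓ u : Vector ℤ n) →
              ⟦ box ℓ u ⟧ ≐ (λ x → ∀ j → fromℤ (ℓ j) ≤ℝ x j × x j ≤ℝ fromℤ (u j))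
box-correct {n} ℓ u = to , from
  where
  upper lower : Polyhedron n
  upper = polyhedron identity (λ i → u i / 1)
  lower = polyhedron (λ i j → - identity i j) (λ i → - (ℓ i / 1))

  seq-lower : ∀ j (x : Vector ℝ n) p → seq ((λ k → - identity j k) ∙ x) p ≡ - seq (x j) p
  seq-lower j x p = trans (seq-negate (identity j) x p) (cong -_ (seq-identity j x p))

  -- Both directions are instances of -a ≤ -b + ε ⇒ b ≤ a + ε.
  flip-≤ : ∀ a b ε → - a ≤ - b + ε → b ≤ a + ε
  flip-≤ a b ε h = subst₂ _≤_ (lhs a b) (rhs′ a b ε) (+-monoʳ-≤ (a + b) h)
    where
    open +-*-Solver
    lhs : ∀ a b → a + b + - a ≡ b
    lhs = solve 2 (λ a b → a :+ b :+ :- a := b) refl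
    rhs′ : ∀ a b ε → a + b + (- b + ε) ≡ a + ε
    rhs′ = solve 3 (λ a b ε → a :+ b :+ (:- b :+ ε) := a :+ ε) refl

  flip-≤⁻¹ : ∀ a b ε → b ≤ a + ε → - a ≤ - b + ε
  flip-≤⁻¹ a b ε h = flip-≤ (- b) (- a) ε
    (subst₂ (λ s t → s ≤ t + ε) (sym (neg-involutive b)) (sym (neg-involutive a)) h)
    where
    open +-*-Solver
    neg-involutive : ∀ a → - (- a) ≡ a
    neg-involutive = solve 1 (λ a → :- (:- a) := a) refl

  lower-to : ∀ {x} j → (λ k → - identity j k) ∙ x ≤ℝ fromℚ (- (ℓ j / 1)) → fromℤ (ℓ j) ≤ℝ x j
  lower-to {x} j h ε 0<ε = proj₁ (h ε 0<ε) , λ p N≤p →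
    flip-≤ (seq (x j) p) (ℓ j / 1) ε
      (subst (_≤ - (ℓ j / 1) + ε) (seq-lower j x p) (proj₂ (h ε 0<ε) p N≤p))

  lower-from : ∀ {x} j → fromℤ (ℓ j) ≤ℝ x j → (λ k → - identity j k) ∙ x ≤ℝ fromℚ (- (ℓ j / 1))
  lower-from {x} j h ε 0<ε = proj₁ (h ε 0<ε) , λ p N≤p →
    subst (_≤ - (ℓ j / 1) + ε) (sym (seq-lower j x p))
      (flip-≤⁻¹ (seq (x j) p) (ℓ j / 1) ε (proj₂ (h ε 0<ε) p N≤p))

  upper-to : ∀ {x} j → identity j ∙ x ≤ℝ fromℤ (u j) → x j ≤ℝ fromℤ (u j)
  upper-to {x} j = ≤ℝ-respˡ {identity j ∙ x} {x j} {fromℤ (u j)} (seq-identity j x)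

  upper-from : ∀ {x} j → x j ≤ℝ fromℤ (u j) → identity j ∙ x ≤ℝ fromℤ (u j)
  upper-from {x} j = ≤ℝ-respˡ {x j} {identity j ∙ x} {fromℤ (u j)} (λ p → sym (seq-identity j x p))

  split-box : ⟦ upper ⊓ᴾ lower ⟧ ≐ ⟦ upper ⟧ ∩ ⟦ lower ⟧
  split-box = ⊓ᴾ-correct upper lower

  to : ∀ {x} → x ∈ ⟦ box ℓ u ⟧ → ∀ j → fromℤ (ℓ j) ≤ℝ x j × x j ≤ℝ fromℤ (u j)
  to {x} h j = lower-to {x} j (proj₂ (proj₁ split-box {x} h) j) ,
               upper-to {x} j (proj₁ (proj₁ split-box {x} h) j)

  from : ∀ {x} → (∀ j → fromℤ (ℓ j) ≤ℝ x j × x j ≤ℝ fromℤ (u j)) → x ∈ ⟦ box ℓ u ⟧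
  from {x} h = proj₂ split-box {x}
    ((λ j → upper-from {x} j (proj₂ (h j))) , (λ j → lower-from {x} j (proj₁ (h j))))

dilate-correct : ∀ {n} (k : ℕ) .{{_ : ℕ.NonZero k}} (P : Polyhedron n) →
                 ⟦ dilate k P ⟧ ≐ (λ x → ∃ λ y → y ∈ ⟦ P ⟧ × (∀ j → x j ≈ℝ (ℤ.+ k / 1) ·ℝ y j))
dilate-correct k P = to , from
  where
  c : ℚ
  c = ℤ.+ k / 1

  instance
    c-positive : Positive c
    c-positive = normalize-pos k 1

    c-nonZero : NonZero c
    c-nonZero = pos⇒nonZero c

    c⁻¹-positive : Positive (1/ c)
    c⁻¹-positive = 1/pos⇒pos c

  c*c⁻¹* : ∀ t → c * (1/ c * t) ≡ t
  c*c⁻¹* t = trans (sym (*-assoc c (1/ c) t))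
                   (trans (cong (_* t) (*-inverseʳ c)) (*-identityˡ t))

  to : ∀ {x} → x ∈ ⟦ dilate k P ⟧ → ∃ λ y → y ∈ ⟦ P ⟧ × (∀ j → x j ≈ℝ c ·ℝ y j)
  to {x} h = (λ j → 1/ c ·ℝ x j) , y∈P , x≈cy
    where
    y∈P : (λ j → 1/ c ·ℝ x j) ∈ ⟦ P ⟧
    y∈P i ε 0<ε = proj₁ b , λ p N≤p →
      *-cancelˡ-≤-pos c (subst₂ _≤_
        (sym (trans (cong (c *_) (seq-scale (1/ c) (matrix P i) x p)) (c*c⁻¹* _)))
        (sym (*-distribˡ-+ c (rhs P i) ε))
        (proj₂ b p N≤p))
      where
      b : ∃ λ N → ∀ p → N ℕ.≤ p → seq (matrix P i ∙ x) p ≤ c * rhs P i + c * ε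
      b = h i (c * ε) (*-pos (positive⁻¹ c) 0<ε)

    x≈cy : ∀ j → x j ≈ℝ c ·ℝ (1/ c ·ℝ x j)
    x≈cy j ε 0<ε = 0 , λ p _ →
      subst (λ t → ∣ t ∣ < ε)
        (sym (trans (cong (λ t → seq (x j) p - t) (c*c⁻¹* (seq (x j) p))) (+-inverseʳ (seq (x j) p))))
        0<ε

  from : ∀ {x} → (∃ λ y → y ∈ ⟦ P ⟧ × (∀ j → x j ≈ℝ c ·ℝ y j)) → x ∈ ⟦ dilate k P ⟧
  from {x} (y , y∈P , x≈cy) i =
    ≈ℝ-≤ℝ-trans (matrix P i ∙ x) (matrix P i ∙ (λ j → c ·ℝ y j)) (fromℚ (c * rhs P i))
      (∙-cong (matrix P i) x (λ j → c ·ℝ y j) x≈cy) cy∈kP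
    where
    cy∈kP : matrix P i ∙ (λ j → c ·ℝ y j) ≤ℝ fromℚ (c * rhs P i)
    cy∈kP ε 0<ε = proj₁ b , λ p N≤p →
      subst₂ _≤_
        (sym (seq-scale c (matrix P i) y p))
        (trans (*-distribˡ-+ c (rhs P i) (1/ c * ε)) (cong ((c * rhs P i) +_) (c*c⁻¹* ε)))
        (*-monoˡ-≤-nonNeg c {{pos⇒nonNeg c}} (proj₂ b p N≤p))
      where
      b : ∃ λ N → ∀ p → N ℕ.≤ p → seq (matrix P i ∙ y) p ≤ rhs P i + 1/ c * ε
      b = y∈P i (1/ c * ε) (*-pos (positive⁻¹ (1/ c)) 0<ε)

{-# OPTIONS --safe #-}
module Submission where

-- A full row rank matrix M is equimodular exactly when, for every invertible column submatrix M_C, each column of M is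
-- an integer combination of the columns of M_C.
--
-- If A is totally equimodular and P = {Ax ≤ b} is integer, let x be a vertex of P ∩ [ℓ, u] and let C be the set of
-- coordinates not fixed by the box.  Some rows R of A tight at x make A_{R,C} invertible.  The face of P given by all
-- tight rows contains an integer point z, and w = x - z satisfies A_R w = 0 with w integral off C.  By Cramer's rule
-- and equimodularity of A_R, w is integral on C as well, hence so is x.
--
-- Conversely, let R be independent rows of A and A_{R,C} invertible.  For b = 0 on R and 1 elsewhere, a large dilation
-- of {Ax ≤ b} is integer.  Its face A_R x = 0 contains a vector x equal to the j-th unit vector off C, and intersecting
-- with a box that fixes the coordinates off C yields an integer such vector.  So column j of A_R is an integer
-- combination of the columns in C.  Hence det A_{R,D} is an integer multiple of det A_{R,C}, and vice versa.

open import Defs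
open import Algebra.Bundles using (CommutativeRing)
open import Data.Bool.Base using (true; false)
open import Data.Fin.Base as Fin using (Fin; zero; suc; toℕ; punchIn; punchOut; splitAt; _↑ˡ_; _↑ʳ_)
import Data.Fin.Properties as Fin
open import Data.Fin.Subset using (Subset; _⊆_; _⊃_; _∪_; ⁅_⁆) renaming (_∈_ to _∈ₛ_)
open import Data.Fin.Subset.Induction using (⊃-wellFounded; Acc; acc)
open import Data.Fin.Subset.Properties using (_∈?_; p⊆p∪q; q⊆p∪q; x∈⁅x⁆; x∈⁅y⁆⇒x≡y; x∈p∪q⁻)
open import Data.Integer.Base as ℤ using (ℤ)
import Data.Integer.Properties as ℤ
open import Data.List.Base as List using (List; []; _∷_; cartesianProductWith)
open import Data.List.Membership.Propositional using () renaming (_∈_ to _∈ₗ_)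
open import Data.List.Membership.Propositional.Properties
  using (∈-cartesianProductWith⁺; ∈-++⁺ˡ; ∈-++⁺ʳ; ∈-tabulate⁺; ∈-allFin)
open import Data.List.Relation.Unary.All as Listₐ using ([]; _∷_) renaming (All to Allₗ)
import Data.List.Relation.Unary.All.Properties as Listₐ
open import Data.List.Relation.Unary.Any using (here; there)
open import Data.Nat.Base as ℕ using (ℕ; zero; suc)
import Data.Nat.Properties as ℕ
open import Data.Product.Base using (∃; ∃₂; _×_; _,_; proj₁; proj₂)
open import Data.Rational.Base
open import Data.Rational.Properties
open import Data.Rational.Solver using (module +-*-Solver)
open import Data.Rational.Unnormalised.Base as ℚᵘ using (mkℚᵘ; *≡*; *≤*)
import Data.Rational.Unnormalised.Properties as ℚᵘ
open import Data.Sum.Base as Sum using (_⊎_; inj₁; inj₂)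
open import Data.Unit.Base using (⊤; tt)
open import Data.Vec.Base using (Vec; []; _∷_; lookup; map; allFin; removeAt; tabulate)
import Data.Vec.Properties as Vec
import Data.Vec.Functional as F
open import Data.Vec.Functional using (Vector)
open import Data.Vec.Functional.Properties using (lookup-++ˡ; lookup-++ʳ)
open import Data.Vec.Membership.Propositional using () renaming (_∈_ to _∈ᵥ_)
open import Data.Vec.Membership.Propositional.Properties using (∈-lookup)
open import Data.Vec.Relation.Unary.All as All using (All; []; _∷_)
import Data.Vec.Relation.Unary.All.Properties as All
open import Data.Vec.Relation.Unary.AllPairs using (AllPairs; []; _∷_)
open import Data.Vec.Relation.Unary.Any using (here; there)
open import Function.Base using (_∘_; id; case_of_)
open import Function.Bundles using (_⇔_; mk⇔)
open import Relation.Binary.Definitions using (tri<; tri≈; tri>)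
open import Relation.Binary.PropositionalEquality
open import Relation.Nullary using (¬_; Dec; yes; no; contradiction)
open import Relation.Nullary.Decidable using (does; dec-true; _⊎-dec_; ¬?; decidable-stable; ¬¬-excluded-middle)
open import Relation.Nullary.Negation using (¬¬-map)
open import Relation.Unary using (Decidable; _∈_)

open import Algebra.Properties.Semiring.Sum (CommutativeRing.semiring +-*-commutativeRing)
  using (sum; sum-cong-≗; *-distribˡ-sum; *-distribʳ-sum; ∑-distrib-+; ∑-comm; sum-remove)

open +-*-Solver using (solve; _:+_; _:*_; _:-_; :-_; _:=_; con)

-- Sums

-- Nonempty faces are witnessed by real points, whose coordinates cannot be compared, while the
-- passage to a vertex needs comparisons. Fourier-Motzkin elimination therefore replaces a real
-- point of a face by a rational one. Vertices exist because the box blocks every direction; {Ax ≤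
-- b} itself may contain lines. Minors are values of an alternating form on arbitrary lists of
-- columns: exchanging a column leaves lists that are unsorted or have repetitions, which
-- `Selection` excludes. Sorting brings them back at the cost of a sign, which neither divisibility
-- nor absolute value notices. Equimodularity enters as divisibility: every minor is an integer
-- multiple of a fixed nonzero one. These multiples form a group, so the vanishing sum behind
-- Cramer's rule can be read modulo them. The large dilation is a common denominator of one rational
-- point in each nonempty face, times a further factor that lifts the right-hand sides outside R
-- above Ax for the vector x at hand.

sum-0 : ∀ {n} (f : Vector ℚ n) → (∀ i → f i ≡ 0ℚ) → sum f ≡ 0ℚ
sum-0 {zero}  f f≗0 = refl
sum-0 {suc n} f f≗0 = trans (cong₂ _+_ (f≗0 zero) (sum-0 (f ∘ suc) (f≗0 ∘ suc))) (+-identityˡ 0ℚ)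

sum-neg : ∀ {n} (f : Vector ℚ n) → sum (λ i → - f i) ≡ - sum f
sum-neg {zero}  f = refl
sum-neg {suc n} f = trans (cong (- f zero +_) (sum-neg (f ∘ suc))) (sym (neg-distrib-+ (f zero) _))

sum-axpy : ∀ {n} a (w f g : Vector ℚ n) →
           a * sum (λ i → w i * f i) - sum (λ i → w i * g i) ≡ sum (λ i → w i * (a * f i - g i))
sum-axpy a w f g = begin
  a * sum (λ i → w i * f i) - sum (λ i → w i * g i)
    ≡⟨ cong₂ _+_ (*-distribˡ-sum a (λ i → w i * f i)) (sym (sum-neg (λ i → w i * g i))) ⟩
  sum (λ i → a * (w i * f i)) + sum (λ i → - (w i * g i))
    ≡⟨ ∑-distrib-+ (λ i → a * (w i * f i)) (λ i → - (w i * g i)) ⟨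
  sum (λ i → a * (w i * f i) - w i * g i)
    ≡⟨ sum-cong-≗ (λ i → arith a (w i) (f i) (g i)) ⟩
  sum (λ i → w i * (a * f i - g i)) ∎
  where
  open ≡-Reasoning
  arith : ∀ a w f g → a * (w * f) - w * g ≡ w * (a * f - g)
  arith = solve 4 (λ a w f g → a :* (w :* f) :- w :* g := w :* (a :* f :- g)) refl

-- Equality up to sign

infix 4 _≡±_

_≡±_ : ℚ → ℚ → Set
p ≡± q = p ≡ q ⊎ p ≡ - q

neg-involutive : ∀ p → - (- p) ≡ p
neg-involutive = solve 1 (λ p → :- (:- p) := p) refl

≡±-neg : ∀ {p q} → p ≡± q → - p ≡± q
≡±-neg         (inj₁ p≡q)  = inj₂ (cong -_ p≡q)
≡±-neg {q = q} (inj₂ p≡-q) = inj₁ (trans (cong -_ p≡-q) (neg-involutive q))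

≡±-trans : ∀ {p q r} → p ≡± q → q ≡± r → p ≡± r
≡±-trans (inj₁ refl) q≡±r = q≡±r
≡±-trans (inj₂ refl) q≡±r = ≡±-neg q≡±r

≡±0 : ∀ {p q} → p ≡± q → q ≡ 0ℚ → p ≡ 0ℚ
≡±0 (inj₁ refl) q≡0  = q≡0
≡±0 (inj₂ refl) refl = refl

∣∣⇒≡± : ∀ {p q} → ∣ p ∣ ≡ ∣ q ∣ → p ≡± q
∣∣⇒≡± {p} {q} h with ∣p∣≡p∨∣p∣≡-p p | ∣p∣≡p∨∣p∣≡-p q
... | inj₁ a | inj₁ b = inj₁ (trans (sym a) (trans h b))
... | inj₁ a | inj₂ b = inj₂ (trans (sym a) (trans h b))
... | inj₂ a | inj₁ b = inj₂ (neg-injective (trans (sym a) (trans h (trans b (sym (neg-involutive q))))))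
... | inj₂ a | inj₂ b = inj₁ (neg-injective (trans (sym a) (trans h b)))

p≡-p⇒p≡0 : ∀ p → p ≡ - p → p ≡ 0ℚ
p≡-p⇒p≡0 p p≡-p = trans (halve p) (trans (cong (λ t → ½ * (p + t)) p≡-p) (cancel p))
  where
  halve : ∀ p → p ≡ ½ * (p + p)
  halve = solve 1 (λ p → p := con ½ :* (p :+ p)) refl
  cancel : ∀ p → ½ * (p + - p) ≡ 0ℚ
  cancel = solve 1 (λ p → con ½ :* (p :+ :- p) := con 0ℚ) refl

-- Alternating multilinear forms

module _ {X : Set} where

  -- Antisymmetry suffices: 2 is invertible in ℚ, so the form vanishes on repeated arguments.
  Alternating : ∀ {r} → (Vec X r → ℚ) → Set
  Alternating {zero}        D = ⊤
  Alternating {suc zero}    D = ⊤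
  Alternating {suc (suc r)} D =
    (∀ x y xs → D (x ∷ y ∷ xs) ≡ - D (y ∷ x ∷ xs)) × (∀ x → Alternating (λ xs → D (x ∷ xs)))

  alternating-∷ : ∀ {r} (D : Vec X (suc r) → ℚ) → Alternating D → ∀ x → Alternating (λ xs → D (x ∷ xs))
  alternating-∷ {zero}  D alt x = tt
  alternating-∷ {suc r} D alt x = proj₂ alt x

  alternating-axpy : ∀ {r} a (f g : Vec X r → ℚ) → Alternating f → Alternating g →
                     Alternating (λ xs → a * f xs - g xs)
  alternating-axpy {zero}        a f g _ _ = tt
  alternating-axpy {suc zero}    a f g _ _ = tt
  alternating-axpy {suc (suc r)} a f g (f-swap , f-tail) (g-swap , g-tail) =
    (λ x y xs → trans (cong₂ (λ s t → a * s - t) (f-swap x y xs) (g-swap x y xs)) (arith a _ _)) ,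
    (λ x → alternating-axpy a (f ∘ (x ∷_)) (g ∘ (x ∷_)) (f-tail x) (g-tail x))
    where
    arith : ∀ a s t → a * (- s) - (- t) ≡ - (a * s - t)
    arith = solve 3 (λ a s t → a :* (:- s) :- (:- t) := :- (a :* s :- t)) refl

  alternating-repeat : ∀ {r} (D : Vec X (suc r) → ℚ) → Alternating D →
                       ∀ {x xs} → x ∈ᵥ xs → D (x ∷ xs) ≡ 0ℚ
  alternating-repeat {suc r} D (swap , _) {xs = x ∷ xs} (here refl) = p≡-p⇒p≡0 _ (swap x x xs)
  alternating-repeat {suc r} D (swap , tail) {x} {xs = y ∷ xs} (there x∈xs) =
    trans (swap x y xs) (cong -_ (alternating-repeat (D ∘ (y ∷_)) (tail y) x∈xs))

  -- Entry `k` moves to the front by adjacent swaps. The sign is not tracked, as no later argument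
  -- depends on it.
  alternating-front : ∀ {r} (D : Vec X (suc r) → ℚ) → Alternating D →
                      ∀ xs k → D xs ≡± D (lookup xs k ∷ removeAt xs k)
  alternating-front D alt (x ∷ xs) zero = inj₁ refl
  alternating-front {suc r} D (swap , tail) (x ∷ xs@(_ ∷ _)) (suc k) =
    ≡±-trans (alternating-front (D ∘ (x ∷_)) (tail x) xs k) (inj₂ (swap x (lookup xs k) (removeAt xs k)))

  -- The exterior product of a linear form with ω, through the rule that contracting φ ∧ ω by x
  -- gives φ(x) ω minus φ ∧ (ω contracted by x). Unlike the Laplace sum, this recursion follows the
  -- list, so that alternation is an induction on it.
  wedge : (X → ℚ) → ∀ {r} → (Vec X r → ℚ) → Vec X (suc r) → ℚ
  wedge φ {zero}  ω (x ∷ xs) = φ x * ω xs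
  wedge φ {suc r} ω (x ∷ xs) = φ x * ω xs - wedge φ (ω ∘ (x ∷_)) xs

  -- Linearity in the second factor. Allowing combinations of any length covers both negation and
  -- the expansion of a column.
  wedge-comb : ∀ φ {r k} (f : Vec X r → ℚ) (w : Vector ℚ k) (g : Fin k → Vec X r → ℚ) →
               (∀ xs → f xs ≡ sum (λ j → w j * g j xs)) →
               ∀ xs → wedge φ f xs ≡ sum (λ j → w j * wedge φ (g j) xs)
  wedge-comb φ {zero} f w g f≗ (x ∷ xs) = begin
    φ x * f xs                        ≡⟨ cong (φ x *_) (f≗ xs) ⟩
    φ x * sum (λ j → w j * g j xs)    ≡⟨ *-distribˡ-sum (φ x) (λ j → w j * g j xs) ⟩
    sum (λ j → φ x * (w j * g j xs))  ≡⟨ sum-cong-≗ (λ j → arith (φ x) (w j) (g j xs)) ⟩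
    sum (λ j → w j * (φ x * g j xs))  ∎
    where
    open ≡-Reasoning
    arith : ∀ a b c → a * (b * c) ≡ b * (a * c)
    arith = solve 3 (λ a b c → a :* (b :* c) := b :* (a :* c)) refl
  wedge-comb φ {suc r} f w g f≗ (x ∷ xs) =
    trans (cong₂ (λ s t → φ x * s - t) (f≗ xs)
            (wedge-comb φ (f ∘ (x ∷_)) w (λ j → g j ∘ (x ∷_)) (f≗ ∘ (x ∷_)) xs))
          (sum-axpy (φ x) w (λ j → g j xs) (λ j → wedge φ (g j ∘ (x ∷_)) xs))

  wedge-neg : ∀ φ {r} (f g : Vec X r → ℚ) → (∀ xs → f xs ≡ - g xs) →
              ∀ xs → wedge φ f xs ≡ - wedge φ g xs
  wedge-neg φ f g f≗-g xs =
    trans (wedge-comb φ f (λ (_ : Fin 1) → - 1ℚ) (λ _ → g) (λ ys → trans (f≗-g ys) (arith (g ys))) xs)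
          (sym (arith (wedge φ g xs)))
    where
    arith : ∀ a → - a ≡ - 1ℚ * a + 0ℚ
    arith = solve 1 (λ a → :- a := :- con 1ℚ :* a :+ con 0ℚ) refl

  alternating-wedge : ∀ φ {r} (ω : Vec X r → ℚ) → Alternating ω → Alternating (wedge φ ω)
  alternating-wedge φ {zero} ω alt = tt
  alternating-wedge φ {suc zero} ω alt =
    (λ { x y [] → arith (φ x) (φ y) (ω (y ∷ [])) (ω (x ∷ [])) }) , (λ x → tt)
    where
    arith : ∀ a b c d → a * c - b * d ≡ - (b * d - a * c)
    arith = solve 4 (λ a b c d → a :* c :- b :* d := :- (b :* d :- a :* c)) refl
  alternating-wedge φ {suc (suc r)} ω (swap , tail) =
    (λ x y xs → trans
      (cong (λ s → φ x * ω (y ∷ xs) - (φ y * ω (x ∷ xs) - s))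
            (wedge-neg φ (ω ∘ (x ∷_) ∘ (y ∷_)) (ω ∘ (y ∷_) ∘ (x ∷_)) (swap x y) xs))
      (arith (φ x * ω (y ∷ xs)) (φ y * ω (x ∷ xs)) _)) ,
    (λ x → alternating-axpy (φ x) ω (wedge φ (ω ∘ (x ∷_))) (swap , tail)
             (alternating-wedge φ (ω ∘ (x ∷_)) (tail x)))
    where
    arith : ∀ a b c → a - (b - (- c)) ≡ - (b - (a - c))
    arith = solve 3 (λ a b c → a :- (b :- (:- c)) := :- (b :- (a :- c))) refl

  wedge-laplace : ∀ φ {r} (ω : Vec X r → ℚ) xs →
                  sum (λ j → sign (toℕ j) * φ (lookup xs j) * ω (removeAt xs j)) ≡ wedge φ ω xs
  wedge-laplace φ {zero} ω (x ∷ []) = arith (φ x) (ω [])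
    where
    arith : ∀ a b → 1ℚ * a * b + 0ℚ ≡ a * b
    arith = solve 2 (λ a b → con 1ℚ :* a :* b :+ con 0ℚ := a :* b) refl
  wedge-laplace φ {suc r} ω (x ∷ xs@(_ ∷ _)) = cong₂ _+_ (arith₀ (φ x) (ω xs)) (begin
    sum (λ j → sign (toℕ (suc j)) * φ (lookup xs j) * ω (x ∷ removeAt xs j))
      ≡⟨ sum-cong-≗ (λ j → arith₁ (sign (toℕ j)) (φ (lookup xs j)) (ω (x ∷ removeAt xs j))) ⟩
    sum (λ j → - (sign (toℕ j) * φ (lookup xs j) * ω (x ∷ removeAt xs j)))
      ≡⟨ sum-neg (λ j → sign (toℕ j) * φ (lookup xs j) * ω (x ∷ removeAt xs j)) ⟩
    - sum (λ j → sign (toℕ j) * φ (lookup xs j) * ω (x ∷ removeAt xs j))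
      ≡⟨ cong -_ (wedge-laplace φ (ω ∘ (x ∷_)) xs) ⟩
    - wedge φ (ω ∘ (x ∷_)) xs ∎)
    where
    open ≡-Reasoning
    arith₀ : ∀ a b → 1ℚ * a * b ≡ a * b
    arith₀ = solve 2 (λ a b → con 1ℚ :* a :* b := a :* b) refl
    arith₁ : ∀ s a b → - s * a * b ≡ - (s * a * b)
    arith₁ = solve 3 (λ s a b → :- s :* a :* b := :- (s :* a :* b)) refl

  -- The exterior product of the rows, that is, the determinant of the listed columns. `X` is a set
  -- of column indices when minors of a fixed matrix are compared, and a space of column vectors
  -- when multilinearity is used; `form-map` links the two.
  form : ∀ {r} → (Fin r → X → ℚ) → Vec X r → ℚ
  form {zero}  φ _ = 1ℚ
  form {suc r} φ   = wedge (φ zero) (form (φ ∘ suc))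

  alternating-form : ∀ {r} (φ : Fin r → X → ℚ) → Alternating (form φ)
  alternating-form {zero}  φ = tt
  alternating-form {suc r} φ = alternating-wedge (φ zero) (form (φ ∘ suc)) (alternating-form (φ ∘ suc))

-- Determinants as alternating forms

det-cong : ∀ {r} {M N : Matrix r r} → (∀ i j → M i j ≡ N i j) → det M ≡ det N
det-cong {zero}  M≗N = refl
det-cong {suc r} M≗N = sum-cong-≗ λ j →
  cong₂ (λ s t → sign (toℕ j) * s * t) (M≗N zero j) (det-cong (λ i k → M≗N (suc i) (punchIn j k)))

lookup-removeAt : ∀ {X : Set} {r} (xs : Vec X (suc r)) j k →
                  lookup (removeAt xs j) k ≡ lookup xs (punchIn j k)
lookup-removeAt (x ∷ xs)         zero    k       = refl
lookup-removeAt (x ∷ xs@(_ ∷ _)) (suc j) zero    = refl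
lookup-removeAt (x ∷ xs@(_ ∷ _)) (suc j) (suc k) = lookup-removeAt xs j k

det≡form : ∀ {X : Set} {r} (φ : Fin r → X → ℚ) xs → det (λ i k → φ i (lookup xs k)) ≡ form φ xs
det≡form {r = zero}  φ xs = refl
det≡form {r = suc r} φ xs = trans
  (sum-cong-≗ λ j → cong (sign (toℕ j) * φ zero (lookup xs j) *_)
    (trans (det-cong λ i k → cong (φ (suc i)) (sym (lookup-removeAt xs j k)))
           (det≡form (φ ∘ suc) (removeAt xs j))))
  (wedge-laplace (φ zero) (form (φ ∘ suc)) xs)

form-map : ∀ {X Y : Set} {r} (φ : Fin r → Y → ℚ) (v : X → Y) xs →
           form φ (map v xs) ≡ form (λ i → φ i ∘ v) xs
form-map φ v xs = begin
  form φ (map v xs)                              ≡⟨ det≡form φ (map v xs) ⟨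
  det (λ i k → φ i (lookup (map v xs) k))        ≡⟨ det-cong (λ i k → cong (φ i) (Vec.lookup-map k v xs)) ⟩
  det (λ i k → φ i (v (lookup xs k)))            ≡⟨ det≡form (λ i → φ i ∘ v) xs ⟩
  form (λ i → φ i ∘ v) xs                        ∎
  where open ≡-Reasoning

-- Forms on column vectors

IsCombination : ∀ {s k} → Vector ℚ k → (Fin k → Vector ℚ s) → Vector ℚ s → Set
IsCombination w v x = ∀ i → x i ≡ sum (λ j → w j * v j i)

Multilinear : ∀ {s r} → (Vec (Vector ℚ s) r → ℚ) → Set
Multilinear {r = zero}  D = ⊤
Multilinear {s} {suc r} D =
  (∀ {k} (w : Vector ℚ k) v x → IsCombination w v x → ∀ xs → D (x ∷ xs) ≡ sum (λ j → w j * D (v j ∷ xs))) ×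
  (∀ x → Multilinear (λ xs → D (x ∷ xs)))

multilinear-axpy : ∀ {s r} a (f g : Vec (Vector ℚ s) r → ℚ) → Multilinear f → Multilinear g →
                   Multilinear (λ xs → a * f xs - g xs)
multilinear-axpy {r = zero}  a f g _ _ = tt
multilinear-axpy {r = suc r} a f g (f-head , f-tail) (g-head , g-tail) =
  (λ w v x x≗ xs → trans (cong₂ (λ s t → a * s - t) (f-head w v x x≗ xs) (g-head w v x x≗ xs))
                         (sum-axpy a w (λ j → f (v j ∷ xs)) (λ j → g (v j ∷ xs)))) ,
  (λ x → multilinear-axpy a (f ∘ (x ∷_)) (g ∘ (x ∷_)) (f-tail x) (g-tail x))

multilinear-wedge : ∀ {s r} (i : Fin s) (ω : Vec (Vector ℚ s) r → ℚ) → Multilinear ω →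
                    Multilinear (wedge (λ x → x i) ω)
multilinear-wedge {r = zero} i ω _ =
  (λ w v x x≗ xs → trans (cong (_* ω xs) (x≗ i))
    (trans (*-distribʳ-sum (ω xs) (λ j → w j * v j i))
           (sum-cong-≗ λ j → *-assoc (w j) (v j i) (ω xs)))) ,
  (λ x → tt)
multilinear-wedge {r = suc r} i ω (head , tail) =
  (λ w v x x≗ xs → begin
    x i * ω xs - wedge φ (ω ∘ (x ∷_)) xs
      ≡⟨ cong₂ (λ s t → s - t) (trans (cong (_* ω xs) (x≗ i)) (*-comm _ (ω xs)))
               (wedge-comb φ (ω ∘ (x ∷_)) w (λ j → ω ∘ (v j ∷_)) (head w v x x≗) xs) ⟩
    ω xs * sum (λ j → w j * v j i) - sum (λ j → w j * wedge φ (ω ∘ (v j ∷_)) xs)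
      ≡⟨ sum-axpy (ω xs) w (λ j → v j i) (λ j → wedge φ (ω ∘ (v j ∷_)) xs) ⟩
    sum (λ j → w j * (ω xs * v j i - wedge φ (ω ∘ (v j ∷_)) xs))
      ≡⟨ sum-cong-≗ (λ j → cong (λ t → w j * (t - wedge φ (ω ∘ (v j ∷_)) xs)) (*-comm (ω xs) (v j i))) ⟩
    sum (λ j → w j * (v j i * ω xs - wedge φ (ω ∘ (v j ∷_)) xs)) ∎) ,
  (λ x → multilinear-axpy (x i) ω (wedge φ (ω ∘ (x ∷_))) (head , tail)
           (multilinear-wedge i (ω ∘ (x ∷_)) (tail x)))
  where
  open ≡-Reasoning
  φ = λ x → x i

-- The rows are picked by `ρ` because the induction removes rows while the vectors keep their
-- dimension.
multilinear-form : ∀ {s r} (ρ : Fin r → Fin s) → Multilinear (form (λ i (x : Vector ℚ s) → x (ρ i)))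
multilinear-form {r = zero}  ρ = tt
multilinear-form {r = suc r} ρ = multilinear-wedge (ρ zero) _ (multilinear-form (ρ ∘ suc))

-- Expanding every argument leaves sums of products of coefficients with values of `D` on lists of
-- the `v j`. It serves twice: with arbitrary coefficients and `Q` = {0}, and with integer
-- coefficients and `Q` the integer multiples of a determinant.
expand : ∀ {s r k} (Z Q : ℚ → Set) → Q 0ℚ → (∀ {p q} → Q p → Q q → Q (p + q)) →
         (∀ {z q} → Z z → Q q → Q (z * q)) →
         (D : Vec (Vector ℚ s) r → ℚ) → Multilinear D →
         (v : Fin k → Vector ℚ s) → (∀ f → Q (D (map v f))) →
         ∀ {xs} → All (λ x → ∃ λ w → (∀ j → Z (w j)) × IsCombination w v x) xs → Q (D xs)
expand Z Q Q0 Q+ Q* D mul v Qf [] = Qf []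
expand Z Q Q0 Q+ Q* D (head , tail) v Qf {x ∷ xs} ((w , Zw , x≗) ∷ comb) =
  subst Q (sym (head w v x x≗ xs))
    (Q-sum λ j → Q* (Zw j) (expand Z Q Q0 Q+ Q* (D ∘ (v j ∷_)) (tail (v j)) v (λ f → Qf (j ∷ f)) comb))
  where
  Q-sum : ∀ {k} {f : Vector ℚ k} → (∀ j → Q (f j)) → Q (sum f)
  Q-sum {zero}  Qf = Q0
  Q-sum {suc k} Qf = Q+ (Qf zero) (Q-sum (Qf ∘ suc))

-- Sorting

Sorted : ∀ {n r} → Vec (Fin n) r → Set
Sorted = AllPairs Fin._<_

-- Meeting an equal entry makes the form vanish. The clause about `All P` stands in for "`zs` is a
-- permutation": it is what restores sortedness when `y` is put back in front of a recursive
-- insertion.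
insert : ∀ {n r} (D : Vec (Fin n) (suc r) → ℚ) → Alternating D → ∀ x {ys} → Sorted ys →
         D (x ∷ ys) ≡ 0ℚ ⊎
         ∃ λ zs → Sorted zs × (∀ {P : Fin n → Set} → All P (x ∷ ys) → All P zs) × D (x ∷ ys) ≡± D zs
insert D alt x [] = inj₂ (x ∷ [] , [] ∷ [] , id , inj₁ refl)
insert {r = suc r} D (swap , tail) x {y ∷ ys} (y<ys ∷ sorted) with Fin.<-cmp x y
... | tri< x<y _ _ = inj₂ (x ∷ y ∷ ys , (x<y ∷ All.map (Fin.<-trans x<y) y<ys) ∷ y<ys ∷ sorted , id , inj₁ refl)
... | tri≈ _ refl _ = inj₁ (p≡-p⇒p≡0 _ (swap x x ys))
... | tri> _ _ y<x with insert (D ∘ (y ∷_)) (tail y) x sorted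
...   | inj₁ D≡0 = inj₁ (trans (swap x y ys) (cong -_ D≡0))
...   | inj₂ (zs , zs-sorted , keep , D≡±) =
  inj₂ (y ∷ zs , keep (y<x ∷ y<ys) ∷ zs-sorted , (λ { (px ∷ py ∷ pys) → py ∷ keep (px ∷ pys) }) ,
        ≡±-trans (inj₂ (swap x y ys)) D≡±)

sort : ∀ {n r} (D : Vec (Fin n) r → ℚ) → Alternating D → ∀ xs →
       D xs ≡ 0ℚ ⊎ ∃ λ ys → Sorted ys × D xs ≡± D ys
sort D alt [] = inj₂ ([] , [] , inj₁ refl)
sort D alt (x ∷ xs) with sort (D ∘ (x ∷_)) (alternating-∷ D alt x) xs
... | inj₁ D≡0 = inj₁ D≡0
... | inj₂ (ys , sorted , D≡±) with insert D alt x sorted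
...   | inj₁ D≡0 = inj₁ (≡±0 D≡± D≡0)
...   | inj₂ (zs , zs-sorted , _ , D≡±′) = inj₂ (zs , zs-sorted , ≡±-trans D≡± D≡±′)

sorted-bound : ∀ {n r} y (ys : Vec (Fin n) r) → Sorted (y ∷ ys) → toℕ y ℕ.+ suc r ℕ.≤ n
sorted-bound {n} y [] _ = subst (ℕ._≤ n) (ℕ.+-comm 1 (toℕ y)) (Fin.toℕ<n y)
sorted-bound {n} {suc r} y (z ∷ zs) ((y<z ∷ _) ∷ sorted) = begin
  toℕ y ℕ.+ suc (suc r)  ≡⟨ ℕ.+-suc (toℕ y) (suc r) ⟩
  suc (toℕ y) ℕ.+ suc r  ≤⟨ ℕ.+-monoˡ-≤ (suc r) y<z ⟩
  toℕ z ℕ.+ suc r        ≤⟨ sorted-bound z zs sorted ⟩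
  n                      ∎
  where open ℕ.≤-Reasoning

-- The head is squeezed: it is at least `a`, and `sorted-bound` leaves room for the remaining
-- entries only if it is at most `a`.
sorted-full : ∀ {n r} a → a ℕ.+ r ≡ n → (ys : Vec (Fin n) r) → Sorted ys → All (λ y → a ℕ.≤ toℕ y) ys →
              ∀ i → toℕ (lookup ys i) ≡ a ℕ.+ toℕ i
sorted-full {n} {suc r} a a+r≡n (y ∷ ys) (y<ys ∷ sorted) (a≤y ∷ _) = λ
  { zero    → trans (sym a≡y) (sym (ℕ.+-identityʳ a))
  ; (suc i) → trans (sorted-full (suc a) (trans (sym (ℕ.+-suc a r)) a+r≡n) ys sorted
                      (All.map (subst (ℕ._< _) (sym a≡y)) y<ys) i)
                    (sym (ℕ.+-suc a (toℕ i))) }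
  where
  a≡y : a ≡ toℕ y
  a≡y = ℕ.≤-antisym a≤y (ℕ.+-cancelʳ-≤ (suc r) (toℕ y) a
    (subst (toℕ y ℕ.+ suc r ℕ.≤_) (sym a+r≡n) (sorted-bound y ys (y<ys ∷ sorted))))

sorted≡allFin : ∀ {r} (ys : Vec (Fin r) r) → Sorted ys → ys ≡ allFin r
sorted≡allFin ys sorted = trans (sym (Vec.tabulate∘lookup ys)) (Vec.tabulate-cong λ i →
  Fin.toℕ-injective (sorted-full 0 refl ys sorted (All.universal (λ _ → ℕ.z≤n) ys) i))

-- `allFin r` is the only sorted list of length r, so an alternating form of top degree is a single
-- number up to sign.
alternating-allFin : ∀ {r} (D : Vec (Fin r) r → ℚ) → Alternating D → ∀ xs →
                     D xs ≡ 0ℚ ⊎ D xs ≡± D (allFin r)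
alternating-allFin D alt xs with sort D alt xs
... | inj₁ D≡0 = inj₁ D≡0
... | inj₂ (ys , sorted , D≡±) = inj₂ (subst (λ zs → D xs ≡± D zs) (sorted≡allFin ys sorted) D≡±)

lookup-sorted : ∀ {n r} {ys : Vec (Fin n) r} → Sorted ys → ∀ {i j} → i Fin.< j → lookup ys i Fin.< lookup ys j
lookup-sorted (y<ys ∷ _)  {zero}  {suc j} _   = All.lookup⁺ y<ys j
lookup-sorted (_ ∷ sorted) {suc i} {suc j} i<j = lookup-sorted sorted (ℕ.s<s⁻¹ i<j)

selection : ∀ {n r} {ys : Vec (Fin n) r} → Sorted ys → Selection r n
selection {ys = ys} sorted .index = lookup ys
selection {ys = ys} sorted .increasing = lookup-sorted sorted

-- Division and dot products over ℚ

inverse : ∀ {t} → t ≢ 0ℚ → ∃ λ u → t * u ≡ 1ℚ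
inverse {t} t≢0 = 1/ t , *-inverseʳ t
  where instance _ = ≢-nonZero t≢0

*-cancel-0 : ∀ {p q} → p ≢ 0ℚ → p * q ≡ 0ℚ → q ≡ 0ℚ
*-cancel-0 {p} {q} p≢0 pq≡0 with u , pu≡1 ← inverse p≢0 = begin
  q            ≡⟨ *-identityˡ q ⟨
  1ℚ * q       ≡⟨ cong (_* q) pu≡1 ⟨
  p * u * q    ≡⟨ arith p u q ⟩
  u * (p * q)  ≡⟨ cong (u *_) pq≡0 ⟩
  u * 0ℚ       ≡⟨ *-zeroʳ u ⟩
  0ℚ           ∎
  where
  open ≡-Reasoning
  arith : ∀ p u q → p * u * q ≡ u * (p * q)
  arith = solve 3 (λ p u q → p :* u :* q := u :* (p :* q)) refl

infix 9 _⋆_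

_⋆_ : ∀ {n} → Vector ℚ n → Vector ℚ n → ℚ
a ⋆ x = sum (λ j → a j * x j)

⋆-cong : ∀ {n} {a b x y : Vector ℚ n} → (∀ j → a j ≡ b j) → (∀ j → x j ≡ y j) → a ⋆ x ≡ b ⋆ y
⋆-cong a≗b x≗y = sum-cong-≗ λ j → cong₂ _*_ (a≗b j) (x≗y j)

⋆-comm : ∀ {n} (a x : Vector ℚ n) → a ⋆ x ≡ x ⋆ a
⋆-comm a x = sum-cong-≗ λ j → *-comm (a j) (x j)

⋆-zeroˡ : ∀ {n} {a : Vector ℚ n} → (∀ j → a j ≡ 0ℚ) → ∀ x → a ⋆ x ≡ 0ℚ
⋆-zeroˡ a≗0 x = sum-0 _ λ j → trans (cong (_* x j) (a≗0 j)) (*-zeroˡ (x j))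

⋆-zeroʳ : ∀ {n} (a : Vector ℚ n) {x} → (∀ j → x j ≡ 0ℚ) → a ⋆ x ≡ 0ℚ
⋆-zeroʳ a {x} x≗0 = trans (⋆-comm a x) (⋆-zeroˡ x≗0 a)

⋆-axpyʳ : ∀ {n} (a x : Vector ℚ n) t y → a ⋆ (λ j → x j + t * y j) ≡ a ⋆ x + t * a ⋆ y
⋆-axpyʳ a x t y = begin
  sum (λ j → a j * (x j + t * y j))               ≡⟨ sum-cong-≗ (λ j → arith (a j) (x j) t (y j)) ⟩
  sum (λ j → a j * x j + t * (a j * y j))         ≡⟨ ∑-distrib-+ (λ j → a j * x j) (λ j → t * (a j * y j)) ⟩
  a ⋆ x + sum (λ j → t * (a j * y j))             ≡⟨ cong (a ⋆ x +_) (*-distribˡ-sum t (λ j → a j * y j)) ⟨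
  a ⋆ x + t * a ⋆ y                               ∎
  where
  open ≡-Reasoning
  arith : ∀ a x t y → a * (x + t * y) ≡ a * x + t * (a * y)
  arith = solve 4 (λ a x t y → a :* (x :+ t :* y) := a :* x :+ t :* (a :* y)) refl

⋆-axpyˡ : ∀ {n} (a b : Vector ℚ n) t x → (λ j → a j + t * b j) ⋆ x ≡ a ⋆ x + t * b ⋆ x
⋆-axpyˡ a b t x = trans (⋆-comm _ x) (trans (⋆-axpyʳ x a t b)
  (cong₂ (λ p q → p + t * q) (⋆-comm x a) (⋆-comm x b)))

⋆-scaleʳ : ∀ {n} (a : Vector ℚ n) t x → a ⋆ (λ j → t * x j) ≡ t * a ⋆ x
⋆-scaleʳ a t x = trans (sum-cong-≗ λ j → arith (a j) t (x j)) (sym (*-distribˡ-sum t (λ j → a j * x j)))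
  where
  arith : ∀ a t x → a * (t * x) ≡ t * (a * x)
  arith = solve 3 (λ a t x → a :* (t :* x) := t :* (a :* x)) refl

⋆-∑ : ∀ {p n} (M : Matrix p n) (c : Vector ℚ p) x →
      sum (λ i → c i * M i ⋆ x) ≡ (λ j → sum (λ i → c i * M i j)) ⋆ x
⋆-∑ M c x = begin
  sum (λ i → c i * M i ⋆ x)                     ≡⟨ sum-cong-≗ (λ i → *-distribˡ-sum (c i) (λ j → M i j * x j)) ⟩
  sum (λ i → sum (λ j → c i * (M i j * x j)))   ≡⟨ ∑-comm (λ i j → c i * (M i j * x j)) ⟩
  sum (λ j → sum (λ i → c i * (M i j * x j)))   ≡⟨ sum-cong-≗ (λ j → trans
                                                     (sum-cong-≗ (λ i → sym (*-assoc (c i) (M i j) (x j))))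
                                                     (sym (*-distribʳ-sum (x j) (λ i → c i * M i j)))) ⟩
  sum (λ j → sum (λ i → c i * M i j) * x j)     ∎
  where open ≡-Reasoning

identity-diag : ∀ {n} (i : Fin n) → identity i i ≡ 1ℚ
identity-diag zero    = refl
identity-diag (suc i) = identity-diag i

identity-off : ∀ {n} {i j : Fin n} → i ≢ j → identity i j ≡ 0ℚ
identity-off {i = zero}  {zero}  i≢j = contradiction refl i≢j
identity-off {i = zero}  {suc j} i≢j = refl
identity-off {i = suc i} {zero}  i≢j = refl
identity-off {i = suc i} {suc j} i≢j = identity-off (i≢j ∘ cong suc)

⋆-identity : ∀ {n} (a : Vector ℚ n) i → a ⋆ identity i ≡ a i
⋆-identity a i = trans (⋆-comm a (identity i)) (sum-identity i a)

-- `Q` is an additive subgroup of ℚ. The subgroups needed are {0} and the integer multiples of a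
-- minor.
sum-extract : ∀ {n} (Q : ℚ → Set) → Q 0ℚ → (∀ {p q} → Q p → Q q → Q (p + q)) → (∀ {p} → Q p → Q (- p)) →
              ∀ (t : Vector ℚ n) k → Q (sum t) → (∀ j → j ≢ k → Q (t j)) → Q (t k)
sum-extract {suc n} Q Q0 Q+ Q- t k Qsum Qt =
  subst Q (trans (cong (λ s → s - rest) (sum-remove {i = k} t)) (arith (t k) rest))
    (Q+ Qsum (Q- (Q-sum (t ∘ punchIn k) (λ j → Qt (punchIn k j) (Fin.punchInᵢ≢i k j)))))
  where
  rest = sum (t ∘ punchIn k)
  Q-sum : ∀ {n} (t : Vector ℚ n) → (∀ j → Q (t j)) → Q (sum t)
  Q-sum {zero}  t Qt = Q0
  Q-sum {suc n} t Qt = Q+ (Qt zero) (Q-sum (t ∘ suc) (Qt ∘ suc))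
  arith : ∀ a b → a + b - b ≡ a
  arith = solve 2 (λ a b → a :+ b :- b := a) refl

sum-extract-0 : ∀ {n} (t : Vector ℚ n) k → sum t ≡ 0ℚ → (∀ j → j ≢ k → t j ≡ 0ℚ) → t k ≡ 0ℚ
sum-extract-0 = sum-extract (_≡ 0ℚ) refl (λ { refl refl → refl }) (λ { refl → refl })

-- Kernels and rank

InKernel : ∀ {p n} → Matrix p n → Vector ℚ n → Set
InKernel M y = ∀ i → M i ⋆ y ≡ 0ℚ

Injective : ∀ {p n} → Matrix p n → Set
Injective M = ∀ y → InKernel M y → ∀ j → y j ≡ 0ℚ

-- Gaussian elimination. Every pivot uses up one row and one column, so the dimension bound comes
-- along with injectivity.
kernel : ∀ {p n} (M : Matrix p n) →
         (∃ λ y → InKernel M y × ∃ λ j → y j ≢ 0ℚ) ⊎ (Injective M × n ℕ.≤ p)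
kernel {n = zero}  M = inj₂ ((λ _ _ ()) , ℕ.z≤n)
kernel {p} {suc n} M with Fin.any? (λ i → ¬? (M i zero ≟ 0ℚ))
... | no M₀≗0 = inj₁ (identity zero , (λ i → trans (⋆-identity (M i) zero)
                        (decidable-stable (M i zero ≟ 0ℚ) (λ M≢0 → M₀≗0 (i , M≢0)))) ,
                      zero , 1≢0)
... | yes (i , pivot≢0) = eliminate M i pivot≢0
  where
  eliminate : ∀ {p} (M : Matrix p (suc n)) i → M i zero ≢ 0ℚ →
              (∃ λ y → InKernel M y × ∃ λ j → y j ≢ 0ℚ) ⊎ (Injective M × suc n ℕ.≤ p)
  eliminate {suc p} M i pivot≢0
    with u , pu≡1 ← inverse pivot≢0
    with kernel (λ k j → M (punchIn i k) (suc j) + - (M (punchIn i k) zero * u) * M i (suc j))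
  ... | inj₁ (y , y∈ker , j , yj≢0) = inj₁ (y₀ F.∷ y , y∈ker′ , suc j , yj≢0)
    where
    s = (M i ∘ suc) ⋆ y
    -- The eliminated coordinate, solved from the pivot row.
    y₀ = - (u * s)
    arith₁ : ∀ p u s → p * (- (u * s)) + s ≡ (1ℚ - p * u) * s
    arith₁ = solve 3 (λ p u s → p :* (:- (u :* s)) :+ s := (con 1ℚ :- p :* u) :* s) refl
    arith₂ : ∀ m u s b → m * (- (u * s)) + b ≡ b + - (m * u) * s
    arith₂ = solve 4 (λ m u s b → m :* (:- (u :* s)) :+ b := b :+ :- (m :* u) :* s) refl
    row-i : M i ⋆ (y₀ F.∷ y) ≡ 0ℚ
    row-i = trans (arith₁ (M i zero) u s) (trans (cong (λ t → (1ℚ - t) * s) pu≡1) (*-zeroˡ s))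
    y∈ker′ : InKernel M (y₀ F.∷ y)
    y∈ker′ k with i Fin.≟ k
    ... | yes refl = row-i
    ... | no i≢k = subst (λ l → M l ⋆ (y₀ F.∷ y) ≡ 0ℚ) (Fin.punchIn-punchOut i≢k)
      (trans (arith₂ (M k′ zero) u s _)
        (trans (sym (⋆-axpyˡ (M k′ ∘ suc) (M i ∘ suc) (- (M k′ zero * u)) y)) (y∈ker (punchOut i≢k))))
      where k′ = punchIn i (punchOut i≢k)
  ... | inj₂ (inj , n≤p) = inj₂ (inj′ , ℕ.s≤s n≤p)
    where
    inj′ : Injective M
    inj′ y y∈ker = λ { zero → *-cancel-0 pivot≢0 y₀≡0 ; (suc j) → y′≗0 j }
      where
      arith : ∀ m p u y s b → b + - (m * u) * s ≡ (m * y + b) - m * u * (p * y + s) - m * y * (1ℚ - p * u)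
      arith = solve 6 (λ m p u y s b → b :+ :- (m :* u) :* s :=
        (m :* y :+ b) :- m :* u :* (p :* y :+ s) :- m :* y :* (con 1ℚ :- p :* u)) refl
      arith′ : ∀ a b → 0ℚ - a * 0ℚ - b * (1ℚ - 1ℚ) ≡ 0ℚ
      arith′ = solve 2 (λ a b → con 0ℚ :- a :* con 0ℚ :- b :* (con 1ℚ :- con 1ℚ) := con 0ℚ) refl
      y′≗0 : ∀ j → y (suc j) ≡ 0ℚ
      y′≗0 = inj (y ∘ suc) λ k → let m = M (punchIn i k) zero in begin
        _ ≡⟨ ⋆-axpyˡ (M (punchIn i k) ∘ suc) (M i ∘ suc) (- (m * u)) (y ∘ suc) ⟩
        _ ≡⟨ arith m (M i zero) u (y zero) ((M i ∘ suc) ⋆ (y ∘ suc)) ((M (punchIn i k) ∘ suc) ⋆ (y ∘ suc)) ⟩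
        M (punchIn i k) ⋆ y - m * u * M i ⋆ y - m * y zero * (1ℚ - M i zero * u)
          ≡⟨ cong₂ (λ r s → r - m * u * s - m * y zero * (1ℚ - M i zero * u)) (y∈ker (punchIn i k)) (y∈ker i) ⟩
        0ℚ - m * u * 0ℚ - m * y zero * (1ℚ - M i zero * u)
          ≡⟨ cong (λ t → 0ℚ - m * u * 0ℚ - m * y zero * (1ℚ - t)) pu≡1 ⟩
        0ℚ - m * u * 0ℚ - m * y zero * (1ℚ - 1ℚ)
          ≡⟨ arith′ (m * u) (m * y zero) ⟩
        0ℚ ∎
        where open ≡-Reasoning
      y₀≡0 : M i zero * y zero ≡ 0ℚ
      y₀≡0 = trans (sym (+-identityʳ _))
        (trans (cong (M i zero * y zero +_) (sym (⋆-zeroʳ (M i ∘ suc) y′≗0))) (y∈ker i))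

injective⇒≤ : ∀ {p n} (M : Matrix p n) → Injective M → n ℕ.≤ p
injective⇒≤ M inj with kernel M
... | inj₁ (y , y∈ker , j , yj≢0) = contradiction (inj y y∈ker j) yj≢0
... | inj₂ (_ , n≤p) = n≤p

-- Independence of the rows is injectivity of the transpose.
independent? : ∀ {p n} (M : Matrix p n) →
               (∃ λ c → (∀ j → sum (λ i → c i * M i j) ≡ 0ℚ) × ∃ λ i → c i ≢ 0ℚ) ⊎
               (LinearlyIndependent M × p ℕ.≤ n)
independent? M = Sum.map
  (λ (c , c∈ker , nz) → c , (λ j → trans (⋆-comm c (λ i → M i j)) (c∈ker j)) , nz)
  (λ (inj , p≤n) → (λ c c∈ker → inj c (λ j → trans (⋆-comm (λ i → M i j) c) (c∈ker j))) , p≤n)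
  (kernel (λ j i → M i j))

-- Row bases and invertible matrices

infixr 9 _∘ₛ_

_∘ₛ_ : ∀ {k m n} → Selection m n → Selection k m → Selection k n
(S ∘ₛ T) .index = index S ∘ index T
(S ∘ₛ T) .increasing = increasing S ∘ increasing T

idₛ : ∀ {n} → Selection n n
idₛ .index = id
idₛ .increasing i<j = i<j

punchInₛ : ∀ {n} → Fin (suc n) → Selection n (suc n)
punchInₛ i .index = punchIn i
punchInₛ i .increasing {j} {k} j<k = Fin.≤∧≢⇒< (Fin.punchIn-mono-≤ i j k (ℕ.<⇒≤ j<k))
  (λ eq → Fin.<⇒≢ j<k (Fin.punchIn-injective i j k eq))

-- A row with nonzero coefficient in a linear relation vanishes wherever the others do, so deleting
-- it does not enlarge the kernel. Once no relation is left, independence and injectivity bound the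
-- number of rows from both sides and the selection is square.
rowBasis : ∀ {p n} (M : Matrix p n) → Injective M →
           ∃ λ (S : Selection n p) → Injective (selectRows M S) × LinearlyIndependent (selectRows M S)
rowBasis M inj with independent? M
rowBasis M inj | inj₂ (ind , p≤n) with refl ← ℕ.≤-antisym p≤n (injective⇒≤ M inj) = idₛ , inj , ind
rowBasis {suc p} M inj | inj₁ (c , c∈ker , i , ci≢0) =
  let S , inj′ , ind′ = rowBasis (M ∘ punchIn i) drop-injective in punchInₛ i ∘ₛ S , inj′ , ind′
  where
  drop-injective : Injective (M ∘ punchIn i)
  drop-injective y y∈ker = inj y λ k → case i Fin.≟ k of λ
    { (yes refl) → *-cancel-0 ci≢0 (sum-extract-0 (λ k → c k * M k ⋆ y) i
                     (trans (⋆-∑ M c y) (⋆-zeroˡ c∈ker y))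
                     (λ k k≢i → trans (cong (c k *_) (row k (k≢i ∘ sym))) (*-zeroʳ (c k))))
    ; (no i≢k) → row k i≢k }
    where
    row : ∀ k → i ≢ k → M k ⋆ y ≡ 0ℚ
    row k i≢k = subst (λ l → M l ⋆ y ≡ 0ℚ) (Fin.punchIn-punchOut i≢k) (y∈ker (punchOut i≢k))

column : ∀ {r n} → Matrix r n → Fin n → Vector ℚ r
column M j i = M i j

-- The matrix with `v` put in front of `B` has more columns than rows, hence a nonzero kernel
-- vector. Its first coordinate cannot vanish, as `B` is injective; dividing by it solves for `v`.
injective⇒surjective : ∀ {r} (B : Matrix r r) → Injective B →
                       ∀ v → ∃ λ w → IsCombination w (column B) v
injective⇒surjective {r} B inj v with kernel (λ i → v i F.∷ B i)
... | inj₂ (_ , r<r) = contradiction r<r (ℕ.n≮n r)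
... | inj₁ (y , y∈ker , j , yj≢0) with y zero ≟ 0ℚ
...   | yes y₀≡0 = contradiction (y≗0 j) yj≢0
  where
  y≗0 : ∀ j → y j ≡ 0ℚ
  y≗0 zero    = y₀≡0
  y≗0 (suc j) = inj (y ∘ suc) (λ i → trans (sym (+-identityˡ _)) (trans (cong (_+ B i ⋆ (y ∘ suc))
    (sym (trans (cong (v i *_) y₀≡0) (*-zeroʳ (v i))))) (y∈ker i))) j
...   | no y₀≢0 with u , y₀u≡1 ← inverse y₀≢0 = (λ j → - u * y (suc j)) , λ i →
  begin
    v i                                           ≡⟨ arith (v i) (y zero) u (B i ⋆ (y ∘ suc)) ⟩
    u * (v i * y zero + B i ⋆ (y ∘ suc)) + v i * (1ℚ - y zero * u) + - u * B i ⋆ (y ∘ suc)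
      ≡⟨ cong₂ (λ s t → u * s + v i * (1ℚ - t) + - u * B i ⋆ (y ∘ suc)) (y∈ker i) y₀u≡1 ⟩
    u * 0ℚ + v i * (1ℚ - 1ℚ) + - u * B i ⋆ (y ∘ suc)
      ≡⟨ arith′ u (v i) (- u * B i ⋆ (y ∘ suc)) ⟩
    - u * B i ⋆ (y ∘ suc)                         ≡⟨ ⋆-scaleʳ (B i) (- u) (y ∘ suc) ⟨
    B i ⋆ (λ j → - u * y (suc j))                 ≡⟨ ⋆-comm (B i) _ ⟩
    sum (λ j → - u * y (suc j) * B i j)           ∎
  where
  open ≡-Reasoning
  arith : ∀ v y u s → v ≡ u * (v * y + s) + v * (1ℚ - y * u) + - u * s
  arith = solve 4 (λ v y u s → v := u :* (v :* y :+ s) :+ v :* (con 1ℚ :- y :* u) :+ :- u :* s) refl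
  arith′ : ∀ u v s → u * 0ℚ + v * (1ℚ - 1ℚ) + s ≡ s
  arith′ = solve 3 (λ u v s → u :* con 0ℚ :+ v :* (con 1ℚ :- con 1ℚ) :+ s := s) refl

-- Determinants of columns

colForm : ∀ {r} → Vec (Vector ℚ r) r → ℚ
colForm = form (λ i x → x i)

colForm-column : ∀ {r n} (M : Matrix r n) xs → colForm (map (column M) xs) ≡ form M xs
colForm-column M xs = form-map (λ i x → x i) (column M) xs

det≡form-allFin : ∀ {r} (B : Matrix r r) → det B ≡ form B (allFin r)
det≡form-allFin {r} B = trans (det-cong λ i k → cong (B i) (sym (Vec.lookup-allFin k))) (det≡form B (allFin r))

det-identity : ∀ r → det (identity {r}) ≡ 1ℚ
det-identity zero    = refl
det-identity (suc r) = trans (cong₂ (λ s t → 1ℚ * 1ℚ * s + t) (det-identity r)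
  (sum-0 {r} _ λ j → arith (sign (toℕ (suc j)))
    (det λ i k → identity (suc i) (punchIn (suc j) k)))) refl
  where
  arith : ∀ s d → s * 0ℚ * d ≡ 0ℚ
  arith = solve 2 (λ s d → s :* con 0ℚ :* d := con 0ℚ) refl

-- The unit vectors are combinations of the columns of `B`. If det B were 0, the form would vanish
-- on all lists of these columns, and with them on the identity matrix.
injective⇒det≢0 : ∀ {r} (B : Matrix r r) → Injective B → det B ≢ 0ℚ
injective⇒det≢0 {r} B inj det≡0 = 1≢0 (begin
  1ℚ                                   ≡⟨ det-identity r ⟨
  det (identity {r})                   ≡⟨ det≡form-allFin (identity {r}) ⟩
  form identity (allFin r)             ≡⟨ colForm-column identity (allFin r) ⟨
  colForm (map (column identity) (allFin r))
    ≡⟨ expand (λ _ → ⊤) (_≡ 0ℚ) refl (λ { refl refl → refl }) (λ { {z} _ refl → *-zeroʳ z })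
         colForm (multilinear-form id) (column B) columns≡0
         (All.universal (λ x → let w , x≗ = injective⇒surjective B inj x in w , (λ _ → tt) , x≗) _) ⟩
  0ℚ                                   ∎)
  where
  open ≡-Reasoning
  columns≡0 : ∀ f → colForm (map (column B) f) ≡ 0ℚ
  columns≡0 f with alternating-allFin (form B) (alternating-form B) f
  ... | inj₁ eq = trans (colForm-column B f) eq
  ... | inj₂ eq = trans (colForm-column B f) (≡±0 eq (trans (sym (det≡form-allFin B)) det≡0))

-- Cramer's rule: replacing the k-th chosen column by the vanishing combination Σ y_j M_j gives a zero minor;
-- expanded, it consists of the term of that column and of terms of columns that were not chosen.
cramer : ∀ {r n} (Q : ℚ → Set) → Q 0ℚ → (∀ {p q} → Q p → Q q → Q (p + q)) → (∀ {p} → Q p → Q (- p)) →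
         (M : Matrix r n) (y : Vector ℚ n) → InKernel M y → (xs : Vec (Fin n) r) →
         (∀ j → (∀ k → j ≢ lookup xs k) → ∀ zs → Q (y j * form M zs)) →
         ∀ k → Q (y (lookup xs k) * form M xs)
cramer {suc r} Q Q0 Q+ Q- M y y∈ker xs Qy k with alternating-front (form M) (alternating-form M) xs k
... | front = sgn front (sum-extract Q Q0 Q+ Q- t (lookup xs k) Qsum Qt)
  where
  rest = removeAt xs k
  t : Vector ℚ _
  t j = y j * form M (j ∷ rest)
  sgn : form M xs ≡± form M (lookup xs k ∷ rest) → Q (t (lookup xs k)) → Q (y (lookup xs k) * form M xs)
  sgn (inj₁ eq) q = subst (λ s → Q (y (lookup xs k) * s)) (sym eq) q
  sgn (inj₂ eq) q = subst Q (trans (neg-distribʳ-* (y (lookup xs k)) _) (cong (y (lookup xs k) *_) (sym eq))) (Q- q)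
  sum≡0 : sum t ≡ 0ℚ
  sum≡0 = begin
    sum (λ j → y j * form M (j ∷ rest))
      ≡⟨ sum-cong-≗ (λ j → cong (y j *_) (sym (colForm-column M (j ∷ rest)))) ⟩
    sum (λ j → y j * colForm (column M j ∷ map (column M) rest))
      ≡⟨ proj₁ (multilinear-form id) y (column M) (λ _ → 0ℚ)
           (λ i → trans (sym (y∈ker i)) (⋆-comm (M i) y)) (map (column M) rest) ⟨
    colForm ((λ _ → 0ℚ) ∷ map (column M) rest)
      ≡⟨ proj₁ (multilinear-form id) {zero} (λ ()) (λ ()) (λ _ → 0ℚ) (λ i → refl) (map (column M) rest) ⟩
    0ℚ ∎
    where open ≡-Reasoning
  Qsum : Q (sum t)
  Qsum = subst Q (sym sum≡0) Q0
  Qt : ∀ j → j ≢ lookup xs k → Q (t j)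
  Qt j j≢ with Fin.any? (λ k′ → j Fin.≟ lookup xs k′)
  ... | no j∉xs = Qy j (λ k′ eq → j∉xs (k′ , eq)) (j ∷ rest)
  -- A chosen column other than the replaced one now occurs twice, so its term vanishes.
  ... | yes (k′ , refl) with k Fin.≟ k′
  ...   | yes refl = contradiction refl j≢
  ...   | no k≢k′ = subst Q (sym (trans (cong (y j *_)
            (alternating-repeat (form M) (alternating-form M) j∈rest)) (*-zeroʳ (y j)))) Q0
    where
    j∈rest : lookup xs k′ ∈ᵥ rest
    j∈rest = subst (_∈ᵥ rest) (trans (lookup-removeAt xs k (punchOut k≢k′))
      (cong (lookup xs) (Fin.punchIn-punchOut k≢k′))) (∈-lookup (punchOut k≢k′) rest)

-- Cramer's rule for the subgroup {0} with every column chosen: the condition on columns that were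
-- not chosen is vacuous.
det≢0⇒injective : ∀ {r} (B : Matrix r r) → det B ≢ 0ℚ → Injective B
det≢0⇒injective {r} B det≢0 y y∈ker k = *-cancel-0 det≢0 (begin
  det B * y k                  ≡⟨ *-comm (det B) (y k) ⟩
  y k * det B                  ≡⟨ cong₂ (λ j d → y j * d) (sym (Vec.lookup-allFin k)) (det≡form-allFin B) ⟩
  y (lookup (allFin r) k) * form B (allFin r)
    ≡⟨ cramer (_≡ 0ℚ) refl (λ { refl refl → refl }) (λ { refl → refl }) B y y∈ker (allFin r)
         (λ j j∉ → contradiction (sym (Vec.lookup-allFin j)) (j∉ j)) k ⟩
  0ℚ                           ∎)
  where open ≡-Reasoning

-- Integers in ℚ

-- Identities between embedded integers are checked on unnormalised fractions, where nothing is
-- reduced to lowest terms.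
toℚᵘ-/1 : ∀ z → toℚᵘ (z / 1) ℚᵘ.≃ mkℚᵘ z 0
toℚᵘ-/1 z = toℚᵘ-fromℚᵘ (mkℚᵘ z 0)

/1-homo-+ : ∀ a b → a / 1 + b / 1 ≡ (a ℤ.+ b) / 1
/1-homo-+ a b = toℚᵘ-injective (begin
  toℚᵘ (a / 1 + b / 1)               ≈⟨ toℚᵘ-homo-+ (a / 1) (b / 1) ⟩
  toℚᵘ (a / 1) ℚᵘ.+ toℚᵘ (b / 1)     ≈⟨ ℚᵘ.+-cong (toℚᵘ-/1 a) (toℚᵘ-/1 b) ⟩
  mkℚᵘ a 0 ℚᵘ.+ mkℚᵘ b 0             ≈⟨ *≡* (cong₂ (λ s t → (s ℤ.+ t) ℤ.* ℤ.+ 1) (ℤ.*-identityʳ a) (ℤ.*-identityʳ b)) ⟩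
  mkℚᵘ (a ℤ.+ b) 0                   ≈⟨ toℚᵘ-/1 (a ℤ.+ b) ⟨
  toℚᵘ ((a ℤ.+ b) / 1)               ∎)
  where open ℚᵘ.≃-Reasoning

/1-homo-* : ∀ a b → a / 1 * (b / 1) ≡ (a ℤ.* b) / 1
/1-homo-* a b = toℚᵘ-injective (begin
  toℚᵘ (a / 1 * (b / 1))             ≈⟨ toℚᵘ-homo-* (a / 1) (b / 1) ⟩
  toℚᵘ (a / 1) ℚᵘ.* toℚᵘ (b / 1)     ≈⟨ ℚᵘ.*-cong (toℚᵘ-/1 a) (toℚᵘ-/1 b) ⟩
  mkℚᵘ (a ℤ.* b) 0                   ≈⟨ toℚᵘ-/1 (a ℤ.* b) ⟨
  toℚᵘ ((a ℤ.* b) / 1)               ∎)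
  where open ℚᵘ.≃-Reasoning

/1-homo-neg : ∀ a → - (a / 1) ≡ (ℤ.- a) / 1
/1-homo-neg a = toℚᵘ-injective (begin
  toℚᵘ (- (a / 1))                   ≈⟨ toℚᵘ-homo‿- (a / 1) ⟩
  ℚᵘ.- toℚᵘ (a / 1)                  ≈⟨ ℚᵘ.-‿cong (toℚᵘ-/1 a) ⟩
  mkℚᵘ (ℤ.- a) 0                     ≈⟨ toℚᵘ-/1 (ℤ.- a) ⟨
  toℚᵘ ((ℤ.- a) / 1)                 ∎)
  where open ℚᵘ.≃-Reasoning

/1-injective : ∀ {a b} → a / 1 ≡ b / 1 → a ≡ b
/1-injective {a} {b} eq with *≡* h ← ℚᵘ.≃-trans (ℚᵘ.≃-sym (toℚᵘ-/1 a)) (ℚᵘ.≃-trans (toℚᵘ-cong eq) (toℚᵘ-/1 b)) =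
  trans (sym (ℤ.*-identityʳ a)) (trans h (ℤ.*-identityʳ b))

IsInt : ℚ → Set
IsInt q = ∃ λ z → q ≡ z / 1

isInt-+ : ∀ {p q} → IsInt p → IsInt q → IsInt (p + q)
isInt-+ (a , refl) (b , refl) = a ℤ.+ b , /1-homo-+ a b

isInt-* : ∀ {p q} → IsInt p → IsInt q → IsInt (p * q)
isInt-* (a , refl) (b , refl) = a ℤ.* b , /1-homo-* a b

isInt-neg : ∀ {p} → IsInt p → IsInt (- p)
isInt-neg (a , refl) = ℤ.- a , /1-homo-neg a

isInt-identity : ∀ {n} (i j : Fin n) → IsInt (identity i j)
isInt-identity zero    zero    = ℤ.+ 1 , refl
isInt-identity zero    (suc j) = ℤ.+ 0 , refl
isInt-identity (suc i) zero    = ℤ.+ 0 , refl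
isInt-identity (suc i) (suc j) = isInt-identity i j

*-denominator : ∀ q → q * (↧ q / 1) ≡ ↥ q / 1
*-denominator q@(mkℚ n d-1 _) = toℚᵘ-injective (begin
  toℚᵘ (q * (↧ q / 1))               ≈⟨ toℚᵘ-homo-* q (↧ q / 1) ⟩
  toℚᵘ q ℚᵘ.* toℚᵘ (↧ q / 1)         ≈⟨ ℚᵘ.*-congˡ {toℚᵘ q} (toℚᵘ-/1 (↧ q)) ⟩
  toℚᵘ q ℚᵘ.* mkℚᵘ (↧ q) 0           ≈⟨ *≡* (trans (ℤ.*-identityʳ (n ℤ.* ↧ q))
                                          (cong (λ d → n ℤ.* ℤ.+ d) (sym (ℕ.*-identityʳ (suc d-1))))) ⟩
  mkℚᵘ (↥ q) 0                       ≈⟨ toℚᵘ-/1 (↥ q) ⟨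
  toℚᵘ (↥ q / 1)                     ∎)
  where open ℚᵘ.≃-Reasoning

fromℕ-nonNeg : ∀ n → 0ℚ ≤ ℤ.+ n / 1
fromℕ-nonNeg n = nonNegative⁻¹ (ℤ.+ n / 1) {{normalize-nonNeg n 1}}

fromℕ-homo-+ : ∀ a b → ℤ.+ (a ℕ.+ b) / 1 ≡ ℤ.+ a / 1 + ℤ.+ b / 1
fromℕ-homo-+ a b = sym (/1-homo-+ (ℤ.+ a) (ℤ.+ b))

archimedean : ∀ q → ∃ λ n → q ≤ ℤ.+ n / 1
archimedean q@record{} = ℤ.∣ ↥ q ∣ , toℚᵘ-cancel-≤ (ℚᵘ.≤-respʳ-≃ (ℚᵘ.≃-sym (toℚᵘ-/1 (ℤ.+ ℤ.∣ ↥ q ∣))) (*≤* (begin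
  ↥ q ℤ.* ℤ.+ 1                ≡⟨ ℤ.*-identityʳ (↥ q) ⟩
  ↥ q                          ≤⟨ i≤∣i∣ (↥ q) ⟩
  ℤ.+ ℤ.∣ ↥ q ∣                ≤⟨ ℤ.+≤+ (ℕ.m≤m*n ℤ.∣ ↥ q ∣ (↧ₙ q)) ⟩
  ℤ.+ (ℤ.∣ ↥ q ∣ ℕ.* ↧ₙ q)     ≡⟨ ℤ.pos-* ℤ.∣ ↥ q ∣ (↧ₙ q) ⟩
  ℤ.+ ℤ.∣ ↥ q ∣ ℤ.* ↧ q        ∎)))
  where
  open ℤ.≤-Reasoning
  i≤∣i∣ : ∀ i → i ℤ.≤ ℤ.+ ℤ.∣ i ∣
  i≤∣i∣ (ℤ.+ n)      = ℤ.≤-refl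
  i≤∣i∣ ℤ.-[1+ n ]   = ℤ.-≤+

unit⇒±1 : ∀ {p q} → IsInt p → IsInt q → p * q ≡ 1ℚ → p ≡± 1ℚ
unit⇒±1 (a , refl) (b , refl) ab≡1 = sgn a
  (ℕ.m*n≡1⇒m≡1 ℤ.∣ a ∣ ℤ.∣ b ∣ (trans (sym (ℤ.abs-* a b)) (cong ℤ.∣_∣ (/1-injective {a ℤ.* b} {ℤ.+ 1} (trans (sym (/1-homo-* a b)) ab≡1)))))
  where
  sgn : ∀ a → ℤ.∣ a ∣ ≡ 1 → a / 1 ≡± 1ℚ
  sgn (ℤ.+ .1)    refl = inj₁ refl
  sgn ℤ.-[1+ .0 ] refl = inj₂ refl

-- Ratio test

posInverse : ∀ {t} → 0ℚ < t → ∃ λ u → 0ℚ < u × t * u ≡ 1ℚ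
posInverse {t} 0<t = 1/ t , positive⁻¹ (1/ t) {{1/pos⇒pos t}} , *-inverseʳ t
  where instance
    _ = positive 0<t
    _ = pos⇒nonZero t

*-monoˡ-0≤ : ∀ {r p q} → 0ℚ ≤ r → p ≤ q → r * p ≤ r * q
*-monoˡ-0≤ {r} 0≤r = *-monoˡ-≤-nonNeg r {{nonNegative 0≤r}}

*-cancelˡ-0< : ∀ {r p q} → 0ℚ < r → r * p ≤ r * q → p ≤ q
*-cancelˡ-0< {r} 0<r = *-cancelˡ-≤-pos r {{positive 0<r}}

module _ {I : Set} (g s : I → ℚ) where

  -- The least quotient `s i / g i` over positive `g i`, compared by cross-multiplication.
  minRatio : ∀ (L : List I) → Allₗ (λ i → g i ≤ 0ℚ) L ⊎
             ∃ λ i → i ∈ₗ L × 0ℚ < g i × Allₗ (λ j → 0ℚ < g j → s i * g j ≤ s j * g i) L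
  minRatio [] = inj₁ []
  minRatio (x ∷ L) with 0ℚ <? g x | minRatio L
  ... | no gx≯0  | inj₁ g≤0 = inj₁ (≮⇒≥ gx≯0 ∷ g≤0)
  ... | no gx≯0  | inj₂ (i , i∈L , 0<gi , min) =
    inj₂ (i , there i∈L , 0<gi , (λ 0<gx → contradiction 0<gx gx≯0) ∷ min)
  ... | yes 0<gx | inj₁ g≤0 = inj₂ (x , here refl , 0<gx , (λ _ → ≤-refl) ∷
    Listₐ.map (λ gj≤0 0<gj → contradiction (<-≤-trans 0<gj gj≤0) (<-irrefl refl)) g≤0)
  ... | yes 0<gx | inj₂ (i , i∈L , 0<gi , min) with ≤-total (s x * g i) (s i * g x)
  ...   | inj₂ i≤x = inj₂ (i , there i∈L , 0<gi , (λ _ → i≤x) ∷ min)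
  ...   | inj₁ x≤i = inj₂ (x , here refl , 0<gx , (λ _ → ≤-refl) ∷
    Listₐ.map (λ {j} i≤j 0<gj → *-cancelˡ-0< 0<gi (begin
      g i * (s x * g j)  ≡⟨ arith (g i) (s x) (g j) ⟩
      g j * (s x * g i)  ≤⟨ *-monoˡ-0≤ (<⇒≤ 0<gj) x≤i ⟩
      g j * (s i * g x)  ≡⟨ arith (g j) (s i) (g x) ⟩
      g x * (s i * g j)  ≤⟨ *-monoˡ-0≤ (<⇒≤ 0<gx) (i≤j 0<gj) ⟩
      g x * (s j * g i)  ≡⟨ arith (g x) (s j) (g i) ⟩
      g i * (s j * g x)  ∎)) min)
    where
    open ≤-Reasoning
    arith : ∀ a b c → a * (b * c) ≡ c * (b * a)
    arith = solve 3 (λ a b c → a :* (b :* c) := c :* (b :* a)) refl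

  -- `t` is the largest step length in direction `g` that the slacks `s` allow. The same test finds
  -- the sharpest bound in a one-variable system.
  ratioTest : ∀ (L : List I) → Allₗ (λ i → g i ≤ 0ℚ) L ⊎
              ∃₂ λ i t → i ∈ₗ L × 0ℚ < g i × t * g i ≡ s i × Allₗ (λ j → 0ℚ < g j → t * g j ≤ s j) L
  ratioTest L with minRatio L
  ... | inj₁ g≤0 = inj₁ g≤0
  ... | inj₂ (i , i∈L , 0<gi , min) with u , 0<u , gu≡1 ← posInverse 0<gi =
    inj₂ (i , s i * u , i∈L , 0<gi , cancel (s i) , Listₐ.map (λ {j} i≤j 0<gj → begin
      s i * u * g j      ≡⟨ arith (s i) u (g j) ⟩
      u * (s i * g j)    ≤⟨ *-monoˡ-0≤ (<⇒≤ 0<u) (i≤j 0<gj) ⟩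
      u * (s j * g i)    ≡⟨ arith (s j) u (g i) ⟨
      s j * u * g i      ≡⟨ cancel (s j) ⟩
      s j                ∎) min)
    where
    open ≤-Reasoning
    arith : ∀ a u g → a * u * g ≡ u * (a * g)
    arith = solve 3 (λ a u g → a :* u :* g := u :* (a :* g)) refl
    arith′ : ∀ a u g → a * u * g ≡ a * (g * u)
    arith′ = solve 3 (λ a u g → a :* u :* g := a :* (g :* u)) refl
    cancel : ∀ a → a * u * g i ≡ a
    cancel a = trans (arith′ a u (g i)) (trans (cong (a *_) gu≡1) (*-identityʳ a))

-- Fourier–Motzkin elimination

Constraint : ℕ → Set
Constraint n = Vector ℚ n × ℚ

Satisfies : ∀ {n} → Vector ℚ n → Constraint n → Set
Satisfies x (a , α) = a ⋆ x ≤ α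

infixl 6 _*ᶜ_+_*ᶜ_
_*ᶜ_+_*ᶜ_ : ∀ {n} → ℚ → Constraint n → ℚ → Constraint n → Constraint n
s *ᶜ (a , α) + t *ᶜ (b , β) = (λ j → s * a j + t * b j) , s * α + t * β

-- Properties of the set of constraints that hold at a point x.  Elimination uses nothing else about x, so it
-- applies to a real x, whose coordinates cannot be compared constructively.
record IsConsistent {n} (V : Constraint n → Set) : Set where
  field
    ext      : ∀ {a b α} → (∀ j → a j ≡ b j) → V (a , α) → V (b , α)
    conic    : ∀ {s t c d} → 0ℚ ≤ s → 0ℚ ≤ t → V c → V d → V (s *ᶜ c + t *ᶜ d)
    sound    : ∀ {a α} → (∀ j → a j ≡ 0ℚ) → V (a , α) → 0ℚ ≤ α

open IsConsistent

-- The solution is the least upper bound on x if there is an upper bound, otherwise the greatest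
-- lower bound, otherwise 0. `pairs` is the cleared form of "every lower bound is at most every
-- upper bound".
solve₁ : ∀ {I : Set} (c r : I → ℚ) (L : List I) →
         (∀ {i} → i ∈ₗ L → c i ≡ 0ℚ → 0ℚ ≤ r i) →
         (∀ {i j} → i ∈ₗ L → j ∈ₗ L → 0ℚ < c i → c j < 0ℚ → 0ℚ ≤ - c j * r i + c i * r j) →
         ∃ λ x → ∀ {i} → i ∈ₗ L → c i * x ≤ r i
solve₁ c r L zeros pairs with ratioTest c r L
... | inj₂ (i , t , i∈L , 0<ci , tci≡ri , min) = t , λ {j} j∈L → below j∈L (<-cmp (c j) 0ℚ)
  where
  below : ∀ {j} → j ∈ₗ L → _ → c j * t ≤ r j
  below {j} j∈L (tri> _ _ 0<cj) = subst (_≤ r j) (*-comm t (c j)) (Listₐ.lookup min j∈L 0<cj)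
  below {j} j∈L (tri≈ _ cj≡0 _) = subst (_≤ r j) (sym (trans (cong (_* t) cj≡0) (*-zeroˡ t))) (zeros j∈L cj≡0)
  below {j} j∈L (tri< cj<0 _ _) = *-cancelˡ-0< 0<ci (begin
    c i * (c j * t)                          ≡⟨ arith (c i) (c j) t ⟩
    c j * (t * c i)                          ≡⟨ cong (c j *_) tci≡ri ⟩
    c j * r i                                ≡⟨ +-identityʳ _ ⟨
    c j * r i + 0ℚ                           ≤⟨ +-monoʳ-≤ (c j * r i) (pairs i∈L j∈L 0<ci cj<0) ⟩
    c j * r i + (- c j * r i + c i * r j)    ≡⟨ arith′ (c j) (r i) (c i * r j) ⟩
    c i * r j                                ∎)
    where
    open ≤-Reasoning
    arith : ∀ a b t → a * (b * t) ≡ b * (t * a)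
    arith = solve 3 (λ a b t → a :* (b :* t) := b :* (t :* a)) refl
    arith′ : ∀ c r s → c * r + (- c * r + s) ≡ s
    arith′ = solve 3 (λ c r s → c :* r :+ (:- c :* r :+ s) := s) refl
... | inj₁ c≤0 with ratioTest (λ i → - c i) r L
-- Negating the coefficients turns lower bounds on x into upper bounds on -x.
...   | inj₂ (i , t , i∈L , 0<-ci , _ , min) = - t , λ {j} j∈L → above j∈L (<-cmp (c j) 0ℚ)
  where
  arith : ∀ c t → c * - t ≡ t * - c
  arith = solve 2 (λ c t → c :* :- t := t :* :- c) refl
  above : ∀ {j} → j ∈ₗ L → _ → c j * - t ≤ r j
  above {j} j∈L (tri> _ _ 0<cj) = contradiction (<-≤-trans 0<cj (Listₐ.lookup c≤0 j∈L)) (<-irrefl refl)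
  above {j} j∈L (tri≈ _ cj≡0 _) = subst (_≤ r j) (sym (trans (cong (_* - t) cj≡0) (*-zeroˡ (- t)))) (zeros j∈L cj≡0)
  above {j} j∈L (tri< cj<0 _ _) = subst (_≤ r j) (sym (arith (c j) t)) (Listₐ.lookup min j∈L (neg-antimono-< cj<0))
...   | inj₁ -c≤0 = 0ℚ , λ {j} j∈L → subst (_≤ r j) (sym (*-zeroʳ (c j))) (zeros j∈L
  (≤-antisym (Listₐ.lookup c≤0 j∈L) (subst (0ℚ ≤_) (neg-involutive (c j)) (neg-antimono-≤ (Listₐ.lookup -c≤0 j∈L)))))

-- Defined for all pairs of leading coefficients, so that elimination combines every pair of
-- constraints without sorting them by sign. Pairs that need no combination receive zero multipliers
-- and contribute 0 ≤ 0.
record Multipliers (a b : ℚ) : Set where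
  field
    s t     : ℚ
    0≤s     : 0ℚ ≤ s
    0≤t     : 0ℚ ≤ t
    cancels : s * a + t * b ≡ 0ℚ
    unit    : a ≡ 0ℚ → s ≡ 1ℚ × t ≡ 0ℚ
    cross   : 0ℚ < a → b < 0ℚ → s ≡ - b × t ≡ a

zeroMultipliers : ∀ {a b} → a ≢ 0ℚ → (0ℚ < a → ¬ (b < 0ℚ)) → Multipliers a b
zeroMultipliers {a} {b} a≢0 b≮0 = record
  { s = 0ℚ ; t = 0ℚ ; 0≤s = ≤-refl ; 0≤t = ≤-refl
  ; cancels = cong₂ _+_ (*-zeroˡ a) (*-zeroˡ b)
  ; unit = λ a≡0 → contradiction a≡0 a≢0
  ; cross = λ 0<a b<0 → contradiction b<0 (b≮0 0<a) }

multipliers : ∀ a b → Multipliers a b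
multipliers a b with <-cmp a 0ℚ
... | tri≈ _ a≡0 a≯0 = record
  { s = 1ℚ ; t = 0ℚ ; 0≤s = nonNegative⁻¹ 1ℚ ; 0≤t = ≤-refl
  ; cancels = cong₂ _+_ (trans (*-identityˡ a) a≡0) (*-zeroˡ b)
  ; unit = λ _ → refl , refl
  ; cross = λ 0<a → contradiction 0<a a≯0 }
... | tri< _ a≢0 a≯0 = zeroMultipliers a≢0 (λ 0<a → contradiction 0<a a≯0)
... | tri> _ a≢0 0<a with b <? 0ℚ
...   | no b≮0 = zeroMultipliers a≢0 (λ _ → b≮0)
...   | yes b<0 = record
  { s = - b ; t = a ; 0≤s = neg-antimono-≤ (<⇒≤ b<0) ; 0≤t = <⇒≤ 0<a
  ; cancels = arith a b
  ; unit = λ a≡0 → contradiction a≡0 a≢0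
  ; cross = λ _ _ → refl , refl }
  where
  arith : ∀ a b → - b * a + a * b ≡ 0ℚ
  arith = solve 2 (λ a b → :- b :* a :+ a :* b := con 0ℚ) refl

-- All derived constraints are conic combinations of the given ones and hence stay in `V`. When no
-- variable is left, `sound` shows that they hold outright, and back substitution recovers the
-- coordinates.
fourierMotzkin : ∀ {n} {V : Constraint n → Set} → IsConsistent V →
                 ∀ (L : List (Constraint n)) → Allₗ V L → ∃ λ x → ∀ {c} → c ∈ₗ L → Satisfies x c
fourierMotzkin {zero} cons L valid = (λ ()) , λ c∈L → sound cons (λ ()) (Listₐ.lookup valid c∈L)
fourierMotzkin {suc n} {V} cons L valid = x₀ F.∷ x , λ {c} c∈L →
  subst (lead c * x₀ + (proj₁ c ∘ suc) ⋆ x ≤_) (cancel (proj₂ c) ((proj₁ c ∘ suc) ⋆ x))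
    (+-monoˡ-≤ ((proj₁ c ∘ suc) ⋆ x) (x₀-sat c∈L))
  where
  cancel : ∀ α s → (α - s) + s ≡ α
  cancel = solve 2 (λ α s → (α :- s) :+ s := α) refl

  lead : Constraint (suc n) → ℚ
  lead c = proj₁ c zero

  tailᶜ : Constraint (suc n) → Constraint n
  tailᶜ (a , α) = a ∘ suc , α

  open Multipliers

  μ : ∀ c d → Multipliers (lead c) (lead d)
  μ c d = multipliers (lead c) (lead d)

  combine : Constraint (suc n) → Constraint (suc n) → Constraint n
  combine c d = s (μ c d) *ᶜ tailᶜ c + t (μ c d) *ᶜ tailᶜ d

  V′ : Constraint n → Set
  V′ (a , α) = V (0ℚ F.∷ a , α)

  cons′ : IsConsistent V′
  cons′ .ext a≗b = ext cons λ { zero → refl ; (suc j) → a≗b j }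
  cons′ .conic {s} {t} 0≤s 0≤t Vc Vd = ext cons (λ { zero → cong₂ _+_ (*-zeroʳ s) (*-zeroʳ t) ; (suc j) → refl })
    (conic cons 0≤s 0≤t Vc Vd)
  cons′ .sound a≗0 = sound cons λ { zero → refl ; (suc j) → a≗0 j }

  combine-valid : ∀ c d → V c → V d → V′ (combine c d)
  combine-valid c d Vc Vd = ext cons (λ { zero → cancels (μ c d) ; (suc j) → refl })
    (conic cons (0≤s (μ c d)) (0≤t (μ c d)) Vc Vd)

  L′ : List (Constraint n)
  L′ = cartesianProductWith combine L L

  L′-valid : Allₗ V′ L′
  L′-valid = Listₐ.cartesianProductWith⁺ (setoid _) (setoid _) combine L L
    λ {c} {d} c∈L d∈L → combine-valid c d (Listₐ.lookup valid c∈L) (Listₐ.lookup valid d∈L)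

  IH : ∃ λ x → ∀ {c} → c ∈ₗ L′ → Satisfies x c
  IH = fourierMotzkin cons′ L′ L′-valid

  x : Vector ℚ n
  x = proj₁ IH

  slack : Constraint (suc n) → ℚ
  slack (a , α) = α - (a ∘ suc) ⋆ x

  slack-combine : ∀ s t α β (a b : Vector ℚ n) → (λ j → s * a j + t * b j) ⋆ x ≤ s * α + t * β →
                  0ℚ ≤ s * (α - a ⋆ x) + t * (β - b ⋆ x)
  slack-combine s t α β a b sat = subst₂ _≤_ (+-inverseʳ A) rearrange (+-monoˡ-≤ (- A) sat)
    where
    A = (λ j → s * a j + t * b j) ⋆ x
    arith : ∀ s t α β a b → s * α + t * β - (s * a + t * b) ≡ s * (α - a) + t * (β - b)
    arith = solve 6 (λ s t α β a b → s :* α :+ t :* β :- (s :* a :+ t :* b) := s :* (α :- a) :+ t :* (β :- b)) refl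
    A≡ : A ≡ s * a ⋆ x + t * b ⋆ x
    A≡ = trans (⋆-axpyˡ (λ j → s * a j) b t x)
               (cong (_+ t * b ⋆ x) (trans (⋆-comm _ x) (trans (⋆-scaleʳ x s a) (cong (s *_) (⋆-comm x a)))))
    rearrange : s * α + t * β - A ≡ s * (α - a ⋆ x) + t * (β - b ⋆ x)
    rearrange = trans (cong (λ A → s * α + t * β - A) A≡) (arith s t α β (a ⋆ x) (b ⋆ x))

  combine-slack : ∀ {c d} → c ∈ₗ L → d ∈ₗ L → 0ℚ ≤ s (μ c d) * slack c + t (μ c d) * slack d
  combine-slack {c} {d} c∈L d∈L =
    slack-combine (s (μ c d)) (t (μ c d)) (proj₂ c) (proj₂ d) (proj₁ c ∘ suc) (proj₁ d ∘ suc)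
      (proj₂ IH (∈-cartesianProductWith⁺ combine c∈L d∈L))

  zeros : ∀ {c} → c ∈ₗ L → lead c ≡ 0ℚ → 0ℚ ≤ slack c
  -- A constraint free of the eliminated variable survives as its pair with itself, whose
  -- multipliers are 1 and 0.
  zeros {c} c∈L c₀≡0 = subst (0ℚ ≤_) (arith (slack c))
    (subst₂ (λ s t → 0ℚ ≤ s * slack c + t * slack c) (proj₁ (unit (μ c c) c₀≡0)) (proj₂ (unit (μ c c) c₀≡0))
      (combine-slack c∈L c∈L))
    where
    arith : ∀ r → 1ℚ * r + 0ℚ * r ≡ r
    arith = solve 1 (λ r → con 1ℚ :* r :+ con 0ℚ :* r := r) refl

  pairs : ∀ {c d} → c ∈ₗ L → d ∈ₗ L → 0ℚ < lead c → lead d < 0ℚ → 0ℚ ≤ - lead d * slack c + lead c * slack d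
  pairs {c} {d} c∈L d∈L 0<c₀ d₀<0 = subst₂ (λ s t → 0ℚ ≤ s * slack c + t * slack d)
    (proj₁ (cross (μ c d) 0<c₀ d₀<0)) (proj₂ (cross (μ c d) 0<c₀ d₀<0)) (combine-slack c∈L d∈L)

  x₀∃ : ∃ λ x₀ → ∀ {c} → c ∈ₗ L → lead c * x₀ ≤ slack c
  x₀∃ = solve₁ lead slack L zeros pairs

  x₀ : ℚ
  x₀ = proj₁ x₀∃

  x₀-sat : ∀ {c} → c ∈ₗ L → lead c * x₀ ≤ slack c
  x₀-sat = proj₂ x₀∃

-- Rational points of polyhedra

tightℚ : ∀ {n} (P : Polyhedron n) → Subset (rows P) → Vector ℚ n → Set
tightℚ P S x = (∀ i → matrix P i ⋆ x ≤ rhs P i) × (∀ i → i ∈ₛ S → matrix P i ⋆ x ≡ rhs P i)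

≤+ε⇒≤ : ∀ {p q} → (∀ ε → 0ℚ < ε → p ≤ q + ε) → p ≤ q
≤+ε⇒≤ {p} {q} h = ≮⇒≥ λ q<p → let m , q<m , m<p = <-dense q<p in
  <-irrefl refl (≤-<-trans (subst (p ≤_) (arith q m) (h (m - q) (subst (_< m - q) (+-inverseʳ q) (+-monoˡ-< (- q) q<m)))) m<p)
  where
  arith : ∀ q m → q + (m - q) ≡ m
  arith = solve 2 (λ q m → q :+ (m :- q) := m) refl

p≤∣p∣ : ∀ p → p ≤ ∣ p ∣
p≤∣p∣ p with ≤-total 0ℚ p
... | inj₁ 0≤p = ≤-reflexive (sym (0≤p⇒∣p∣≡p 0≤p))
... | inj₂ p≤0 = ≤-trans p≤0 (0≤∣p∣ p)

≈ℝ⇒≥ℝ : ∀ x y → x ≈ℝ y → y ≤ℝ x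
≈ℝ⇒≥ℝ x y x≈y ε 0<ε with N , h ← x≈y ε 0<ε = N , λ p N≤p →
  subst₂ _≤_ (arith (seq x p) (seq y p)) (+-comm ε (seq x p))
    (+-monoˡ-≤ (seq x p) (≤-trans (p≤∣p∣ _) (subst (_≤ ε) (sym (∣-p∣≡∣p∣ (seq x p - seq y p))) (<⇒≤ (h p N≤p)))))
  where
  arith : ∀ a b → - (a - b) + a ≡ b
  arith = solve 2 (λ a b → :- (a :- b) :+ a := b) refl

fromℚ-cancel-≤ : ∀ {p q} → fromℚ p ≤ℝ fromℚ q → p ≤ q
fromℚ-cancel-≤ p≤q = ≤+ε⇒≤ λ ε 0<ε → let N , h = p≤q ε 0<ε in h N ℕ.≤-refl

seq-⋆ : ∀ {n} a (x : Vector ℚ n) p → seq (a ∙ (fromℚ ∘ x)) p ≡ a ⋆ x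
seq-⋆ a x p = seq-∙ a (fromℚ ∘ x) p

tight⇒tightℚ : ∀ {n} (P : Polyhedron n) S x → (fromℚ ∘ x) ∈ tight P S → tightℚ P S x
tight⇒tightℚ P S x (ineq , eq) =
  (λ i → fromℚ-cancel-≤ (const-≤ i (ineq i))) ,
  (λ i i∈S → ≤-antisym (fromℚ-cancel-≤ (const-≤ i (ineq i)))
    (fromℚ-cancel-≤ (λ ε 0<ε → let N , h = ≈ℝ⇒≥ℝ (matrix P i ∙ (fromℚ ∘ x)) (fromℚ (rhs P i)) (eq i i∈S) ε 0<ε in
      N , λ p N≤p → subst (λ t → rhs P i ≤ t + ε) (seq-⋆ (matrix P i) x p) (h p N≤p))))
  where
  const-≤ : ∀ i → matrix P i ∙ (fromℚ ∘ x) ≤ℝ fromℚ (rhs P i) → fromℚ (matrix P i ⋆ x) ≤ℝ fromℚ (rhs P i)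
  const-≤ i = ≤ℝ-respˡ {matrix P i ∙ (fromℚ ∘ x)} {fromℚ (matrix P i ⋆ x)} {fromℚ (rhs P i)} (seq-⋆ (matrix P i) x)

tightℚ⇒tight : ∀ {n} (P : Polyhedron n) S x → tightℚ P S x → (fromℚ ∘ x) ∈ tight P S
tightℚ⇒tight P S x (ineq , eq) =
  (λ i ε 0<ε → 0 , λ p _ → subst (_≤ rhs P i + ε) (sym (seq-⋆ (matrix P i) x p))
    (subst (_≤ rhs P i + ε) (+-identityʳ _) (+-mono-≤ (ineq i) (<⇒≤ 0<ε)))) ,
  (λ i i∈S ε 0<ε → 0 , λ p _ → subst (λ t → ∣ t ∣ < ε)
    (sym (trans (cong (_- rhs P i) (trans (seq-⋆ (matrix P i) x p) (eq i i∈S))) (+-inverseʳ (rhs P i)))) 0<ε)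

module _ {n} (x : Vector ℝ n) where

  HoldsAt : Constraint n → Set
  HoldsAt (a , α) = a ∙ x ≤ℝ fromℚ α

  private
    at : ℕ → Vector ℚ n
    at p j = seq (x j) p

  holdsAt-consistent : IsConsistent HoldsAt
  holdsAt-consistent .ext {a} {b} {α} a≗b = ≤ℝ-respˡ {a ∙ x} {b ∙ x} {fromℚ α} λ p →
    trans (seq-∙ a x p) (trans (⋆-cong {x = at p} a≗b (λ _ → refl)) (sym (seq-∙ b x p)))
  holdsAt-consistent .conic {s} {t} {a , α} {b , β} 0≤s 0≤t Va Vb ε 0<ε
    -- The error is scaled by 1/(s + t + 1), so that the two errors weighted by s and t stay within
    -- ε; the summand 1 keeps the divisor positive when s = t = 0.
    with u , 0<u , cu≡1 ← posInverse {s + t + 1ℚ} (+-mono-≤-< (+-mono-≤ 0≤s 0≤t) (positive⁻¹ 1ℚ))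
    with 0<uε ← subst (_< u * ε) (*-zeroʳ u) (*-monoʳ-<-pos u {{positive 0<u}} 0<ε)
    with N , hN ← Va (u * ε) 0<uε | M , hM ← Vb (u * ε) 0<uε = N ℕ.⊔ M , λ p ≤p → begin
      seq ((λ j → s * a j + t * b j) ∙ x) p
        ≡⟨ seq-∙ (λ j → s * a j + t * b j) x p ⟩
      (λ j → s * a j + t * b j) ⋆ at p
        ≡⟨ ⋆-axpyˡ (λ j → s * a j) b t (at p) ⟩
      (λ j → s * a j) ⋆ at p + t * b ⋆ at p
        ≡⟨ cong (_+ t * b ⋆ at p) (trans (⋆-comm _ (at p)) (trans (⋆-scaleʳ (at p) s a) (cong (s *_) (⋆-comm (at p) a)))) ⟩
      s * a ⋆ at p + t * b ⋆ at p
        ≤⟨ +-mono-≤ (*-monoˡ-0≤ 0≤s (subst (_≤ α + u * ε) (seq-∙ a x p) (hN p (ℕ.m⊔n≤o⇒m≤o N M ≤p))))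
                    (*-monoˡ-0≤ 0≤t (subst (_≤ β + u * ε) (seq-∙ b x p) (hM p (ℕ.m⊔n≤o⇒n≤o N M ≤p)))) ⟩
      s * (α + u * ε) + t * (β + u * ε)
        ≡⟨ +-identityʳ _ ⟨
      s * (α + u * ε) + t * (β + u * ε) + 0ℚ
        ≤⟨ +-monoʳ-≤ (s * (α + u * ε) + t * (β + u * ε)) (<⇒≤ 0<uε) ⟩
      s * (α + u * ε) + t * (β + u * ε) + u * ε
        ≡⟨ arith s t α β u ε ⟩
      s * α + t * β + (s + t + 1ℚ) * u * ε
        ≡⟨ cong (λ c → s * α + t * β + c) (trans (cong (_* ε) cu≡1) (*-identityˡ ε)) ⟩
      s * α + t * β + ε ∎
    where
    open ≤-Reasoning
    arith : ∀ s t α β u ε → s * (α + u * ε) + t * (β + u * ε) + u * ε ≡ s * α + t * β + (s + t + 1ℚ) * u * ε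
    arith = solve 6 (λ s t α β u ε → s :* (α :+ u :* ε) :+ t :* (β :+ u :* ε) :+ u :* ε :=
      s :* α :+ t :* β :+ (s :+ t :+ con 1ℚ) :* u :* ε) refl
  holdsAt-consistent .sound {a} {α} a≗0 Va = fromℚ-cancel-≤
    (≤ℝ-respˡ {a ∙ x} {fromℚ 0ℚ} {fromℚ α} (λ p → trans (seq-∙ a x p) (⋆-zeroˡ a≗0 (at p))) Va)

neg-⋆ : ∀ {n} (a x : Vector ℚ n) → (λ j → - a j) ⋆ x ≡ - a ⋆ x
neg-⋆ a x = trans (sum-cong-≗ λ j → sym (neg-distribˡ-* (a j) (x j))) (sum-neg λ j → a j * x j)

≈ℝ⇒-≤ℝ : ∀ x y q → (∀ p → seq y p ≡ - seq x p) → x ≈ℝ fromℚ q → y ≤ℝ fromℚ (- q)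
≈ℝ⇒-≤ℝ x y q y≗-x x≈q ε 0<ε =
  let N , h = ≈ℝ⇒≥ℝ x (fromℚ q) x≈q ε 0<ε in N , λ p N≤p →
    subst₂ _≤_ (trans (arith₁ (seq x p) q) (sym (y≗-x p))) (arith₂ (seq x p) q ε)
      (+-monoʳ-≤ (- seq x p - q) (h p N≤p))
  where
  arith₁ : ∀ a b → (- a - b) + b ≡ - a
  arith₁ = solve 2 (λ a b → (:- a :- b) :+ b := :- a) refl
  arith₂ : ∀ a b ε → (- a - b) + (a + ε) ≡ - b + ε
  arith₂ = solve 3 (λ a b ε → (:- a :- b) :+ (a :+ ε) := :- b :+ ε) refl

-- The constraints valid at the real point x include the reversed inequalities of the rows in `S`. A
-- rational solution of all of them satisfies these rows with equality.
rationalPoint : ∀ {n} (P : Polyhedron n) S x → x ∈ tight P S → ∃ (tightℚ P S)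
rationalPoint {n} P S x (ineq , eq) = fromSolution (fourierMotzkin (holdsAt-consistent x) (L₁ List.++ L₂)
  (Listₐ.++⁺ (Listₐ.tabulate⁺ ineq) (Listₐ.tabulate⁺ (λ i → reverse-valid i (i ∈? S)))))
  where
  reverse : ∀ i → Dec (i ∈ₛ S) → Constraint n
  reverse i (yes _) = (λ j → - matrix P i j) , - rhs P i
  -- Rows outside `S` have nothing to reverse and are merely repeated.
  reverse i (no _)  = matrix P i , rhs P i

  L₁ L₂ : List (Constraint n)
  L₁ = List.tabulate (λ i → matrix P i , rhs P i)
  L₂ = List.tabulate (λ i → reverse i (i ∈? S))

  reverse-valid : ∀ i d → HoldsAt x (reverse i d)
  reverse-valid i (no _) = ineq i
  reverse-valid i (yes i∈S) = ≈ℝ⇒-≤ℝ (matrix P i ∙ x) ((λ j → - matrix P i j) ∙ x) (rhs P i)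
    (seq-negate (matrix P i) x) (eq i i∈S)

  reverse-sat : ∀ i d y → i ∈ₛ S → Satisfies y (reverse i d) → rhs P i ≤ matrix P i ⋆ y
  reverse-sat i (no i∉S) y i∈S _   = contradiction i∈S i∉S
  reverse-sat i (yes _)  y _   sat = subst₂ _≤_ (neg-involutive (rhs P i)) (neg-involutive (matrix P i ⋆ y))
    (neg-antimono-≤ (subst (_≤ - rhs P i) (neg-⋆ (matrix P i) y) sat))

  fromSolution : (∃ λ y → ∀ {c} → c ∈ₗ L₁ List.++ L₂ → Satisfies y c) → ∃ (tightℚ P S)
  fromSolution (y , sat) = y , ineqℚ , λ i i∈S → ≤-antisym (ineqℚ i)
    (reverse-sat i (i ∈? S) y i∈S (sat (∈-++⁺ʳ L₁ (∈-tabulate⁺ {f = λ i → reverse i (i ∈? S)} i))))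
    where
    ineqℚ : ∀ i → matrix P i ⋆ y ≤ rhs P i
    ineqℚ i = sat (∈-++⁺ˡ {xs = L₁} (∈-tabulate⁺ {f = λ i → matrix P i , rhs P i} i))

-- Agrees with `IsInteger`, as every nonempty face has a rational point.
IsIntegerℚ : ∀ {n} → Polyhedron n → Set
IsIntegerℚ {n} P = ∀ S → ∃ (tightℚ P S) → ∃ λ (z : Vector ℤ n) → tightℚ P S (λ j → z j / 1)

isInteger⇒ℚ : ∀ {n} (P : Polyhedron n) → IsInteger P → IsIntegerℚ P
isInteger⇒ℚ P int S (x , x∈) =
  let z , z∈ = int S (fromℚ ∘ x , tightℚ⇒tight P S x x∈) in z , tight⇒tightℚ P S (λ j → z j / 1) z∈

isIntegerℚ⇒ : ∀ {n} (P : Polyhedron n) → IsIntegerℚ P → IsInteger P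
isIntegerℚ⇒ P int S (x , x∈) =
  let z , z∈ = int S (rationalPoint P S x x∈) in z , tightℚ⇒tight P S (λ j → z j / 1) z∈

tightℚ-cong : ∀ {n} (P : Polyhedron n) {S x y} → (∀ j → x j ≡ y j) → tightℚ P S x → tightℚ P S y
tightℚ-cong P x≗y (ineq , eq) =
  (λ i → subst (_≤ rhs P i) (⋆-cong {a = matrix P i} (λ _ → refl) x≗y) (ineq i)) ,
  (λ i i∈S → trans (⋆-cong {a = matrix P i} (λ _ → refl) (sym ∘ x≗y)) (eq i i∈S))

-- Vertices

-- For a set `T` of rows tight at a feasible point, this says that the point is a vertex.
InjectiveOn : ∀ {p n} → Subset p → Matrix p n → Set
InjectiveOn T M = ∀ y → (∀ i → i ∈ₛ T → M i ⋆ y ≡ 0ℚ) → ∀ j → y j ≡ 0ℚ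

kernelOn : ∀ {p n} T (M : Matrix p n) →
           (∃ λ y → (∀ i → i ∈ₛ T → M i ⋆ y ≡ 0ℚ) × ∃ λ j → y j ≢ 0ℚ) ⊎ InjectiveOn T M
kernelOn {n = n} T M = Sum.map
  (λ (y , y∈ker , nz) → y , (λ i i∈T → unmasked y i (i ∈? T) i∈T (y∈ker i)) , nz)
  (λ (inj , _) y y∈ker → inj y (λ i → masked y i (i ∈? T) (y∈ker i)))
  (kernel (λ i → mask i (i ∈? T)))
  where
  mask : ∀ i → Dec (i ∈ₛ T) → Vector ℚ n
  mask i (yes _) = M i
  mask i (no _)  = λ _ → 0ℚ
  unmasked : ∀ y i d → i ∈ₛ T → mask i d ⋆ y ≡ 0ℚ → M i ⋆ y ≡ 0ℚ
  unmasked y i (yes _)  _   eq = eq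
  unmasked y i (no i∉T) i∈T _  = contradiction i∈T i∉T
  masked : ∀ y i d → (i ∈ₛ T → M i ⋆ y ≡ 0ℚ) → mask i d ⋆ y ≡ 0ℚ
  masked y i (yes i∈T) eq = eq i∈T
  masked y i (no _)    _  = ⋆-zeroˡ (λ _ → refl) y

-- Move along a direction in the kernel of the tight rows until a further row becomes tight.
vertex : ∀ {n} (P : Polyhedron n) → (∀ d j → d j ≢ 0ℚ → ∃ λ i → 0ℚ < matrix P i ⋆ d) →
         ∀ S → Acc _⊃_ S → ∀ x → tightℚ P S x →
         ∃₂ λ T y → S ⊆ T × tightℚ P T y × InjectiveOn T (matrix P)
vertex {n} P bounded S (acc rec) x (ineq , eq) with kernelOn S (matrix P)
... | inj₂ inj = S , x , id , (ineq , eq) , inj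
... | inj₁ (d , d∈ker , j , dj≢0)
  with ratioTest (λ i → matrix P i ⋆ d) (λ i → rhs P i - matrix P i ⋆ x) (List.allFin (rows P))
-- `bounded` excludes a direction in which no row increases.
...   | inj₁ g≤0 = let i , 0<gi = bounded d j dj≢0 in
                   contradiction (<-≤-trans 0<gi (Listₐ.lookup g≤0 (∈-allFin i))) (<-irrefl refl)
...   | inj₂ (i , t , _ , 0<gi , tgi≡si , min) =
  let T , z , S′⊆T , rest = vertex P bounded (S ∪ ⁅ i ⁆) (rec S⊂S′) y (ineq′ , eq′) in
  T , z , S′⊆T ∘ p⊆p∪q ⁅ i ⁆ , rest
  where
  g s : Fin (rows P) → ℚ
  g k = matrix P k ⋆ d
  s k = rhs P k - matrix P k ⋆ x

  y : Vector ℚ n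
  y j = x j + t * d j

  row : ∀ k → matrix P k ⋆ y ≡ matrix P k ⋆ x + t * g k
  row k = ⋆-axpyʳ (matrix P k) x t d

  s≥0 : ∀ k → 0ℚ ≤ s k
  s≥0 k = subst (_≤ s k) (+-inverseʳ (matrix P k ⋆ x)) (+-monoˡ-≤ (- matrix P k ⋆ x) (ineq k))

  t≥0 : 0ℚ ≤ t
  t≥0 = *-cancelˡ-0< 0<gi (subst₂ _≤_ (sym (*-zeroʳ (g i))) (trans (sym tgi≡si) (*-comm t (g i))) (s≥0 i))

  step : ∀ k → t * g k ≤ s k
  step k with 0ℚ <? g k
  ... | yes 0<gk = Listₐ.lookup min (∈-allFin k) 0<gk
  -- A row that does not increase along d cannot lose slack, since t is nonnegative.
  ... | no gk≯0 = ≤-trans (subst (t * g k ≤_) (*-zeroʳ t) (*-monoˡ-0≤ t≥0 (≮⇒≥ gk≯0))) (s≥0 k)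

  arith : ∀ a b → a + (b - a) ≡ b
  arith = solve 2 (λ a b → a :+ (b :- a) := b) refl

  ineq′ : ∀ k → matrix P k ⋆ y ≤ rhs P k
  ineq′ k = subst₂ _≤_ (sym (row k)) (arith (matrix P k ⋆ x) (rhs P k)) (+-monoʳ-≤ (matrix P k ⋆ x) (step k))

  eq′ : ∀ k → k ∈ₛ S ∪ ⁅ i ⁆ → matrix P k ⋆ y ≡ rhs P k
  eq′ k k∈ with x∈p∪q⁻ S ⁅ i ⁆ k∈
  ... | inj₁ k∈S = trans (row k) (trans (cong (λ g → matrix P k ⋆ x + t * g) (d∈ker k k∈S))
    (trans (cong (matrix P k ⋆ x +_) (*-zeroʳ t)) (trans (+-identityʳ _) (eq k k∈S))))
  ... | inj₂ k∈i with refl ← x∈⁅y⁆⇒x≡y i k∈i =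
    trans (row i) (trans (cong (matrix P i ⋆ x +_) tgi≡si) (arith (matrix P i ⋆ x) (rhs P i)))

  -- The blocking row is new: d annihilates the rows in `S` but not row i.
  S⊂S′ : (S ∪ ⁅ i ⁆) ⊃ S
  S⊂S′ = p⊆p∪q ⁅ i ⁆ , i , q⊆p∪q S ⁅ i ⁆ (x∈⁅x⁆ i) , λ i∈S → <-irrefl (sym (d∈ker i i∈S)) 0<gi

-- Selections

index-injective : ∀ {r n} (S : Selection r n) {i j} → index S i ≡ index S j → i ≡ j
index-injective S {i} {j} eq with Fin.<-cmp i j
... | tri< i<j _ _ = contradiction eq (Fin.<⇒≢ (increasing S i<j))
... | tri≈ _ i≡j _ = i≡j
... | tri> _ _ j<i = contradiction (sym eq) (Fin.<⇒≢ (increasing S j<i))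

enumerate : ∀ {n} {Q : Fin n → Set} → Decidable Q →
            ∃₂ λ r (S : Selection r n) → (∀ k → Q (index S k)) × (∀ j → Q j → ∃ λ k → index S k ≡ j)
enumerate {zero}  Q? = 0 , idₛ , (λ ()) , λ ()
enumerate {suc n} Q? with enumerate (Q? ∘ suc) | Q? zero
... | r , S , sound , complete | no ¬Q₀ = r , S⁺ , sound , λ
  { zero Q₀ → contradiction Q₀ ¬Q₀ ; (suc j) Qj → let k , eq = complete j Qj in k , cong suc eq }
  where
  S⁺ : Selection r (suc n)
  S⁺ .index = suc ∘ index S
  S⁺ .increasing i<j = ℕ.s<s (increasing S i<j)
... | r , S , sound , complete | yes Q₀ = suc r , S⁺ , (λ { zero → Q₀ ; (suc k) → sound k }) , λ
  { zero _ → zero , refl ; (suc j) Qj → let k , eq = complete j Qj in suc k , cong suc eq }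
  where
  S⁺ : Selection (suc r) (suc n)
  S⁺ .index zero    = zero
  S⁺ .index (suc k) = suc (index S k)
  S⁺ .increasing {zero}  {suc j} _   = ℕ.z<s
  S⁺ .increasing {suc i} {suc j} i<j = ℕ.s<s (increasing S (ℕ.s<s⁻¹ i<j))

toSubset : ∀ {n} {Q : Fin n → Set} → Decidable Q → Subset n
toSubset Q? = tabulate (does ∘ Q?)

∈-toSubset⁺ : ∀ {n} {Q : Fin n → Set} (Q? : Decidable Q) {i} → Q i → i ∈ₛ toSubset Q?
∈-toSubset⁺ Q? {i} Qi = Vec.lookup⇒[]= i (toSubset Q?)
  (trans (Vec.lookup∘tabulate (does ∘ Q?) i) (dec-true (Q? i) Qi))

∈-toSubset⁻ : ∀ {n} {Q : Fin n → Set} (Q? : Decidable Q) {i} → i ∈ₛ toSubset Q? → Q i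
∈-toSubset⁻ Q? {i} i∈ = does-≡-true (Q? i)
  (trans (sym (Vec.lookup∘tabulate (does ∘ Q?) i)) (Vec.[]=⇒lookup i∈))
  where
  does-≡-true : ∀ {P : Set} (P? : Dec P) → does P? ≡ true → P
  does-≡-true (yes p) _ = p

-- Padding by zeros, written as a combination of unit vectors so that `⋆-∑` computes products with
-- it.
extend : ∀ {r n} → Selection r n → Vector ℚ r → Vector ℚ n
extend C y j = sum (λ k → y k * identity (index C k) j)

⋆-extend : ∀ {r n} (C : Selection r n) a y → a ⋆ extend C y ≡ (a ∘ index C) ⋆ y
⋆-extend C a y = begin
  a ⋆ extend C y                               ≡⟨ ⋆-comm a (extend C y) ⟩
  extend C y ⋆ a                               ≡⟨ ⋆-∑ (identity ∘ index C) y a ⟨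
  sum (λ k → y k * identity (index C k) ⋆ a)   ≡⟨ sum-cong-≗ (λ k → cong (y k *_) (sum-identity (index C k) a)) ⟩
  y ⋆ (a ∘ index C)                            ≡⟨ ⋆-comm y (a ∘ index C) ⟩
  (a ∘ index C) ⋆ y                            ∎
  where open ≡-Reasoning

extend-on : ∀ {r n} (C : Selection r n) y k → extend C y (index C k) ≡ y k
extend-on C y k = trans (sum-cong-≗ λ k′ → cong (y k′ *_) (identity-index k′)) (⋆-identity y k)
  where
  identity-index : ∀ k′ → identity (index C k′) (index C k) ≡ identity k k′
  identity-index k′ with k Fin.≟ k′
  ... | yes refl = identity-diag (index C k)
  ... | no k≢k′  = identity-off (λ eq → k≢k′ (sym (index-injective C eq)))

extend-off : ∀ {r n} (C : Selection r n) y {j} → (∀ k → index C k ≢ j) → extend C y j ≡ 0ℚ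
extend-off C y j∉C = sum-0 _ λ k → trans (cong (y k *_) (identity-off (j∉C k))) (*-zeroʳ (y k))

form-columns : ∀ {r n} (M : Matrix r n) (C : Selection r n) →
               form M (tabulate (index C)) ≡ det (selectColumns M C)
form-columns M C = trans (sym (det≡form M (tabulate (index C))))
  (det-cong λ i k → cong (M i) (Vec.lookup∘tabulate (index C) k))

-- Integer multiples

_∈ℤ·_ : ℚ → ℚ → Set
q ∈ℤ· δ = ∃ λ c → IsInt c × q ≡ c * δ

∈ℤ·-zero : ∀ {δ} → 0ℚ ∈ℤ· δ
∈ℤ·-zero {δ} = 0ℚ , (ℤ.+ 0 , refl) , sym (*-zeroˡ δ)

∈ℤ·-+ : ∀ {δ p q} → p ∈ℤ· δ → q ∈ℤ· δ → (p + q) ∈ℤ· δ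
∈ℤ·-+ {δ} (a , ia , refl) (b , ib , refl) = a + b , isInt-+ ia ib , sym (*-distribʳ-+ δ a b)

∈ℤ·-neg : ∀ {δ p} → p ∈ℤ· δ → (- p) ∈ℤ· δ
∈ℤ·-neg {δ} (a , ia , refl) = - a , isInt-neg ia , neg-distribˡ-* a δ

∈ℤ·-* : ∀ {δ c p} → IsInt c → p ∈ℤ· δ → (c * p) ∈ℤ· δ
∈ℤ·-* {δ} {c} ic (a , ia , refl) = c * a , isInt-* ic ia , sym (*-assoc c a δ)

∈ℤ·-± : ∀ {δ p} → p ≡± δ → p ∈ℤ· δ
∈ℤ·-± {δ} (inj₁ refl) = 1ℚ , (ℤ.+ 1 , refl) , sym (*-identityˡ δ)
∈ℤ·-± {δ} (inj₂ refl) = ∈ℤ·-neg (1ℚ , (ℤ.+ 1 , refl) , sym (*-identityˡ δ))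

∈ℤ·-cancel : ∀ {δ p} → δ ≢ 0ℚ → (p * δ) ∈ℤ· δ → IsInt p
∈ℤ·-cancel {δ} {p} δ≢0 (c , ic , pδ≡cδ) = subst IsInt (sym p≡c) ic
  where
  arith : ∀ p c δ → δ * (p - c) ≡ p * δ - c * δ
  arith = solve 3 (λ p c δ → δ :* (p :- c) := p :* δ :- c :* δ) refl
  arith′ : ∀ p c → p ≡ p - c + c
  arith′ = solve 2 (λ p c → p := p :- c :+ c) refl
  p≡c : p ≡ c
  p≡c = trans (arith′ p c) (trans (cong (_+ c) (*-cancel-0 δ≢0
    (trans (arith p c δ) (trans (cong (_- c * δ) pδ≡cδ) (+-inverseʳ (c * δ)))))) (+-identityˡ c))

-- Sorting turns the list into a `Selection` unless the form vanishes, so the minor is 0 or ±δ.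
-- Membership in the multiples of δ is the weaker conclusion that, unlike "0 or ±δ", is closed under
-- sums.
equimodular-minor : ∀ {r n} (M : Matrix r n) → Equimodular M → ∀ C → det (selectColumns M C) ≢ 0ℚ →
                    ∀ xs → form M xs ∈ℤ· det (selectColumns M C)
equimodular-minor M (_ , equal) C δ≢0 xs with sort (form M) (alternating-form M) xs
... | inj₁ ≡0 = subst (_∈ℤ· _) (sym ≡0) ∈ℤ·-zero
... | inj₂ (ys , sorted , fxs≡±) with form M ys ≟ 0ℚ
...   | yes fys≡0 = subst (_∈ℤ· _) (sym (≡±0 fxs≡± fys≡0)) ∈ℤ·-zero
...   | no fys≢0 = ∈ℤ·-± (≡±-trans fxs≡± (subst (_≡± _) (det≡form M ys)
    (∣∣⇒≡± (equal (selection sorted) C (fys≢0 ∘ trans (sym (det≡form M ys))) δ≢0))))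

-- From total equimodularity to box-integrality

↑-elim : ∀ {m n} (Q : Fin (m ℕ.+ n) → Set) → (∀ i → Q (i ↑ˡ n)) → (∀ j → Q (m ↑ʳ j)) → ∀ k → Q k
↑-elim {m} {n} Q Qˡ Qʳ k = subst Q (Fin.join-splitAt m n k) (Sum.[_,_] {C = Q ∘ Fin.join m n} Qˡ Qʳ (splitAt m k))

module _ {m n} (A : Matrix m n) (b : Vector ℚ m) (ℓ u : Vector ℤ n) where

  boxed : Polyhedron n
  boxed = polyhedron A b ⊓ᴾ box ℓ u

  fromA : Fin m → Fin (rows boxed)
  fromA i = i ↑ˡ (n ℕ.+ n)

  upper lower : Fin n → Fin (rows boxed)
  upper j = m ↑ʳ (j ↑ˡ n)
  lower j = m ↑ʳ (n ↑ʳ j)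

  rows-elim : (Q : Fin (rows boxed) → Set) → (∀ i → Q (fromA i)) → (∀ j → Q (upper j)) → (∀ j → Q (lower j)) →
              ∀ k → Q k
  rows-elim Q QA QU QL = ↑-elim Q QA (↑-elim (Q ∘ (m ↑ʳ_)) QU QL)

  private
    I -I : Matrix n n
    I  = identity
    -I = λ i j → - identity i j

  matrix-fromA : ∀ i → matrix boxed (fromA i) ≡ A i
  matrix-fromA = lookup-++ˡ A (I F.++ -I)

  rhs-fromA : ∀ i → rhs boxed (fromA i) ≡ b i
  rhs-fromA = lookup-++ˡ b (rhs (box ℓ u))

  matrix-upper : ∀ j → matrix boxed (upper j) ≡ identity j
  matrix-upper j = trans (lookup-++ʳ A (I F.++ -I) (j ↑ˡ n)) (lookup-++ˡ I -I j)

  rhs-upper : ∀ j → rhs boxed (upper j) ≡ u j / 1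
  rhs-upper j = trans (lookup-++ʳ b (rhs (box ℓ u)) (j ↑ˡ n)) (lookup-++ˡ (λ j → u j / 1) (λ j → - (ℓ j / 1)) j)

  matrix-lower : ∀ j → matrix boxed (lower j) ≡ λ k → - identity j k
  matrix-lower j = trans (lookup-++ʳ A (I F.++ -I) (n ↑ʳ j)) (lookup-++ʳ I -I j)

  rhs-lower : ∀ j → rhs boxed (lower j) ≡ - (ℓ j / 1)
  rhs-lower j = trans (lookup-++ʳ b (rhs (box ℓ u)) (n ↑ʳ j)) (lookup-++ʳ (λ j → u j / 1) (λ j → - (ℓ j / 1)) j)

  ⋆-fromA : ∀ i x → matrix boxed (fromA i) ⋆ x ≡ A i ⋆ x
  ⋆-fromA i x = cong (_⋆ x) (matrix-fromA i)

  ⋆-upper : ∀ j x → matrix boxed (upper j) ⋆ x ≡ x j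
  ⋆-upper j x = trans (cong (_⋆ x) (matrix-upper j)) (sum-identity j x)

  ⋆-lower : ∀ j x → matrix boxed (lower j) ⋆ x ≡ - x j
  ⋆-lower j x = trans (cong (_⋆ x) (matrix-lower j)) (trans (neg-⋆ (identity j) x) (cong -_ (sum-identity j x)))

  boxed-bounded : ∀ d j → d j ≢ 0ℚ → ∃ λ i → 0ℚ < matrix boxed i ⋆ d
  boxed-bounded d j dj≢0 with <-cmp (d j) 0ℚ
  ... | tri< dj<0 _ _ = lower j , subst (0ℚ <_) (sym (⋆-lower j d)) (neg-antimono-< dj<0)
  ... | tri≈ _ dj≡0 _ = contradiction dj≡0 dj≢0
  ... | tri> _ _ 0<dj = upper j , subst (0ℚ <_) (sym (⋆-upper j d)) 0<dj

  vertex-integer : TotallyEquimodular A → IsIntegerℚ (polyhedron A b) →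
                   ∀ T x → tightℚ boxed T x → InjectiveOn T (matrix boxed) → ∀ j → IsInt (x j)
  vertex-integer te int T x (ineq , eq) inj j = subst IsInt (arith (x j) (z j / 1)) (isInt-+ (w-int j) (z j , refl))
    where
    arith : ∀ p q → p + - 1ℚ * q + q ≡ p
    arith = solve 2 (λ p q → p :+ :- con 1ℚ :* q :+ q := p) refl

    Fixed : Fin n → Set
    Fixed j = upper j ∈ₛ T ⊎ lower j ∈ₛ T

    fixed? : Decidable Fixed
    fixed? j = upper j ∈? T ⊎-dec lower j ∈? T

    fixed-int : ∀ {j} → Fixed j → IsInt (x j)
    fixed-int {j} (inj₁ ∈T) = u j , trans (sym (⋆-upper j x)) (trans (eq (upper j) ∈T) (rhs-upper j))
    fixed-int {j} (inj₂ ∈T) = ℓ j , neg-injective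
      (trans (sym (⋆-lower j x)) (trans (eq (lower j) ∈T) (rhs-lower j)))

    -- The face is taken in {Ax ≤ b} alone; its integer point may lie outside the box.
    T-A : Subset m
    T-A = toSubset (λ i → fromA i ∈? T)

    integerPoint : ∃ λ z → tightℚ (polyhedron A b) T-A (λ j → z j / 1)
    integerPoint = int T-A (x ,
      (λ i → subst₂ _≤_ (⋆-fromA i x) (rhs-fromA i) (ineq (fromA i))) ,
      (λ i i∈ → trans (sym (⋆-fromA i x)) (trans (eq (fromA i) (∈-toSubset⁻ (λ i → fromA i ∈? T) i∈)) (rhs-fromA i))))

    z : Vector ℤ n
    z = proj₁ integerPoint

    w : Vector ℚ n
    w j = x j + - 1ℚ * (z j / 1)

    w-fixed : ∀ {j} → Fixed j → IsInt (w j)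
    w-fixed {j} fixed = isInt-+ (fixed-int fixed) (isInt-* (isInt-neg (ℤ.+ 1 , refl)) (z j , refl))

    w-kernel : ∀ {i} → fromA i ∈ₛ T → A i ⋆ w ≡ 0ℚ
    w-kernel {i} i∈T = begin
      A i ⋆ w                                    ≡⟨ ⋆-axpyʳ (A i) x (- 1ℚ) (λ j → z j / 1) ⟩
      A i ⋆ x + - 1ℚ * A i ⋆ (λ j → z j / 1)     ≡⟨ cong₂ (λ p q → p + - 1ℚ * q)
        (trans (sym (⋆-fromA i x)) (trans (eq (fromA i) i∈T) (rhs-fromA i)))
        (proj₂ (proj₂ integerPoint) i (∈-toSubset⁺ (λ i → fromA i ∈? T) i∈T)) ⟩
      b i + - 1ℚ * b i                           ≡⟨ cancel (b i) ⟩
      0ℚ                                         ∎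
      where
      open ≡-Reasoning
      cancel : ∀ b → b + - 1ℚ * b ≡ 0ℚ
      cancel = solve 1 (λ b → b :+ :- con 1ℚ :* b := con 0ℚ) refl

    enumC = enumerate (λ j → ¬? (fixed? j))
    enumR = enumerate (λ i → fromA i ∈? T)
    C  = proj₁ (proj₂ enumC)
    R₀ = proj₁ (proj₂ enumR)

    fixed-off-C : ∀ {j} → (∀ k → index C k ≢ j) → Fixed j
    fixed-off-C {j} j∉C = decidable-stable (fixed? j) λ ¬fixed →
      let k , eq = proj₂ (proj₂ (proj₂ enumC)) j ¬fixed in j∉C k eq

    -- Padded by zeros, a vector in this kernel is annihilated by all rows in `T`: the tight box
    -- rows only see fixed coordinates, where it is 0. At a vertex it must vanish.
    C-injective : Injective (λ i → A (index R₀ i) ∘ index C)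
    C-injective y y∈ker k = trans (sym (extend-on C y k)) (inj (extend C y)
      (rows-elim (λ k → k ∈ₛ T → matrix boxed k ⋆ extend C y ≡ 0ℚ)
        (λ i i∈T → let i′ , eq = proj₂ (proj₂ (proj₂ enumR)) i i∈T in
          trans (⋆-fromA i (extend C y)) (trans (⋆-extend C (A i) y)
            (subst (λ i → (A i ∘ index C) ⋆ y ≡ 0ℚ) eq (y∈ker i′))))
        (λ j j∈T → trans (⋆-upper j (extend C y)) (off (inj₁ j∈T)))
        (λ j j∈T → trans (⋆-lower j (extend C y)) (cong -_ (off (inj₂ j∈T)))))
      (index C k))
      where
      off : ∀ {j} → Fixed j → extend C y j ≡ 0ℚ
      off {j} fixed = extend-off C y λ { k refl → proj₁ (proj₂ (proj₂ enumC)) k fixed }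

    basis = rowBasis (λ i → A (index R₀ i) ∘ index C) C-injective
    R = R₀ ∘ₛ proj₁ basis

    M = selectRows A R

    M-equimodular : Equimodular M
    -- A relation between the full rows restricts to the columns in `C`, on which the rows are
    -- independent.
    M-equimodular = te R λ c c∈ker → proj₂ (proj₂ basis) c (λ k → c∈ker (index C k))

    δ≢0 : det (selectColumns M C) ≢ 0ℚ
    δ≢0 = injective⇒det≢0 (selectColumns M C) (proj₁ (proj₂ basis))

    w-int-C : ∀ k → IsInt (w (index C k))
    -- Off `C` the coordinates of w are integers and all minors are multiples of δ, so Cramer's rule
    -- places `w (index C k) * δ` in ℤδ.
    w-int-C k = ∈ℤ·-cancel δ≢0 (subst₂ (λ j δ → (w j * δ) ∈ℤ· det (selectColumns M C))
      (Vec.lookup∘tabulate (index C) k) (form-columns M C)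
      (cramer (_∈ℤ· det (selectColumns M C)) ∈ℤ·-zero ∈ℤ·-+ ∈ℤ·-neg M w
        (λ i → w-kernel (proj₁ (proj₂ (proj₂ enumR)) (index (proj₁ basis) i)))
        (tabulate (index C))
        (λ j j∉C zs → ∈ℤ·-* (w-fixed (fixed-off-C λ k eq → j∉C k (trans (sym eq) (sym (Vec.lookup∘tabulate (index C) k)))))
          (equimodular-minor M M-equimodular C δ≢0 zs))
        k))

    w-int : ∀ j → IsInt (w j)
    w-int j with fixed? j
    ... | yes fixed = w-fixed fixed
    ... | no ¬fixed = let k , eq = proj₂ (proj₂ (proj₂ enumC)) j ¬fixed in subst (IsInt ∘ w) eq (w-int-C k)

  boxed-integer : TotallyEquimodular A → IsIntegerℚ (polyhedron A b) → IsIntegerℚ boxed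
  boxed-integer te int S (x , x∈) =
    let T , y , S⊆T , (ineq , eq) , inj = vertex boxed boxed-bounded S (⊃-wellFounded S) x x∈
        y-int = vertex-integer te int T y (ineq , eq) inj
    in proj₁ ∘ y-int , tightℚ-cong boxed (proj₂ ∘ y-int) (ineq , λ i i∈S → eq i (S⊆T i∈S))

-- Scaling polyhedra to integer polyhedra

fromℕ-mono-≤ : ∀ {a b} → a ℕ.≤ b → ℤ.+ a / 1 ≤ ℤ.+ b / 1
fromℕ-mono-≤ {a} {b} a≤b = begin
  ℤ.+ a / 1                          ≡⟨ +-identityʳ (ℤ.+ a / 1) ⟨
  ℤ.+ a / 1 + 0ℚ                     ≤⟨ +-monoʳ-≤ (ℤ.+ a / 1) (fromℕ-nonNeg (b ℕ.∸ a)) ⟩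
  ℤ.+ a / 1 + ℤ.+ (b ℕ.∸ a) / 1      ≡⟨ fromℕ-homo-+ a (b ℕ.∸ a) ⟨
  ℤ.+ (a ℕ.+ (b ℕ.∸ a)) / 1          ≡⟨ cong (λ c → ℤ.+ c / 1) (ℕ.m+[n∸m]≡n a≤b) ⟩
  ℤ.+ b / 1                          ∎
  where open ≤-Reasoning

fromℕ-homo-* : ∀ a b → ℤ.+ (a ℕ.* b) / 1 ≡ ℤ.+ a / 1 * (ℤ.+ b / 1)
fromℕ-homo-* a b = sym (trans (/1-homo-* (ℤ.+ a) (ℤ.+ b)) (cong (_/ 1) (sym (ℤ.pos-* a b))))

upperBound : ∀ {n} (f : Vector ℚ n) → ∃ λ K → ∀ i → f i ≤ ℤ.+ K / 1
upperBound {zero}  f = 0 , λ ()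
upperBound {suc n} f =
  let K , f₀≤K = archimedean (f zero) ; L , f≤L = upperBound (f ∘ suc) in
  K ℕ.+ L , λ { zero    → ≤-trans f₀≤K (fromℕ-mono-≤ (ℕ.m≤m+n K L))
              ; (suc i) → ≤-trans (f≤L i) (fromℕ-mono-≤ (ℕ.m≤n+m L K)) }

commonDenominator : ∀ {n} (x : Vector ℚ n) → ∃ λ k → ∀ j → IsInt (ℤ.+ suc k / 1 * x j)
commonDenominator {zero}  x = 0 , λ ()
commonDenominator {suc n} x = let k , int = commonDenominator (x ∘ suc) in
  -- The predecessor of `suc k ℕ.* ↧ₙ (x zero)`.
  ℚ.denominator-1 (x zero) ℕ.+ k ℕ.* ↧ₙ (x zero) ,
    λ { zero    → multiple (suc k) {ℤ.+ ↧ₙ (x zero) / 1} {x zero} (suc k ℕ.* ↧ₙ (x zero)) (fromℕ-homo-* (suc k) (↧ₙ (x zero)))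
                      (↥ x zero , trans (*-comm _ (x zero)) (*-denominator (x zero)))
        ; (suc j) → multiple (↧ₙ (x zero)) {ℤ.+ suc k / 1} {x (suc j)} (suc k ℕ.* ↧ₙ (x zero))
                      (trans (fromℕ-homo-* (suc k) (↧ₙ (x zero))) (*-comm (ℤ.+ suc k / 1) (ℤ.+ ↧ₙ (x zero) / 1))) (int j) }
  where
  multiple : ∀ a {c x} k → ℤ.+ k / 1 ≡ ℤ.+ a / 1 * c → IsInt (c * x) → IsInt (ℤ.+ k / 1 * x)
  multiple a {c} {x} k eq int = subst IsInt (sym (trans (cong (_* x) eq) (*-assoc (ℤ.+ a / 1) c x)))
    (isInt-* (ℤ.+ a , refl) int)

tightℚ-scale : ∀ {m n} (A : Matrix m n) (d d′ : Vector ℚ m) {S x} c → 0ℚ ≤ c → (∀ i → c * d i ≡ d′ i) →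
               tightℚ (polyhedron A d) S x → tightℚ (polyhedron A d′) S (λ j → c * x j)
tightℚ-scale A d d′ {x = x} c 0≤c cd≡d′ (ineq , eq) =
  (λ i → subst₂ _≤_ (sym (⋆-scaleʳ (A i) c x)) (cd≡d′ i) (*-monoˡ-0≤ 0≤c (ineq i))) ,
  (λ i i∈S → trans (⋆-scaleʳ (A i) c x) (trans (cong (c *_) (eq i i∈S)) (cd≡d′ i)))

-- Double negation commutes with the finite conjunction over all subsets. The factors found for the
-- two halves are multiplied, which is why `Q` has to be closed under multiples.
uniform : ∀ {m} (Q : Subset m → ℕ → Set) → (∀ S K {k} → Q S k → Q S (K ℕ.* k)) →
          (∀ S → ¬ ¬ ∃ λ k → Q S (suc k)) → ¬ ¬ ∃ λ k → ∀ S → Q S (suc k)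
uniform {zero} Q mult h none = h [] λ (k , q) → none (k , λ { [] → q })
uniform {suc m} Q mult h none =
  uniform (Q ∘ (true ∷_)) (mult ∘ (true ∷_)) (h ∘ (true ∷_)) λ (k , q) →
  uniform (Q ∘ (false ∷_)) (mult ∘ (false ∷_)) (h ∘ (false ∷_)) λ (l , r) →
  -- The predecessor of `suc k ℕ.* suc l`.
  none (l ℕ.+ k ℕ.* suc l , λ
    { (true ∷ S)  → subst (Q (true ∷ S)) (ℕ.*-comm (suc l) (suc k)) (mult (true ∷ S) (suc l) (q S))
    ; (false ∷ S) → mult (false ∷ S) (suc k) (r S) })

-- Doubly negated because deciding which faces are empty is avoided; harmless, as equality in ℚ is stable.
integerDilation : ∀ {n} (P : Polyhedron n) → ¬ ¬ ∃ λ k → ∀ K → IsIntegerℚ (dilate (suc K ℕ.* suc k) P)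
-- Keeping the multiplier `K` free allows the dilation to be chosen as large as a later vector
-- requires.
integerDilation {n} P = ¬¬-map (λ (k , q) → k , λ K → integer (k ℕ.+ K ℕ.* suc k) (λ S → multiple S (suc K) {suc k} (q S)))
  (uniform FaceInteger multiple λ S → ¬¬-map (scale S) ¬¬-excluded-middle)
  where
  -- Nonemptiness is asked of the face of `P`, not of its dilation, so that the hypothesis is the
  -- same for all `k`.
  FaceInteger : Subset (rows P) → ℕ → Set
  FaceInteger S k = ∃ (tightℚ P S) → ∃ λ (z : Vector ℤ n) → tightℚ (dilate k P) S (λ j → z j / 1)

  multiple : ∀ S K {k} → FaceInteger S k → FaceInteger S (K ℕ.* k)
  multiple S K {k} int nonempty = let z , z∈ = int nonempty in
    (λ j → ℤ.+ K ℤ.* z j) , tightℚ-cong (dilate (K ℕ.* k) P) (λ j → /1-homo-* (ℤ.+ K) (z j))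
      (tightℚ-scale (matrix P) (rhs (dilate k P)) (rhs (dilate (K ℕ.* k) P)) (ℤ.+ K / 1) (fromℕ-nonNeg K)
        (λ i → trans (sym (*-assoc (ℤ.+ K / 1) (ℤ.+ k / 1) (rhs P i))) (cong (_* rhs P i) (sym (fromℕ-homo-* K k)))) z∈)

  scale : ∀ S → Dec (∃ (tightℚ P S)) → ∃ λ k → FaceInteger S (suc k)
  scale S (no empty) = 0 , λ nonempty → contradiction nonempty empty
  scale S (yes (x , x∈)) = let k , int = commonDenominator x in k , λ _ →
    proj₁ ∘ int , tightℚ-cong (dilate (suc k) P) (proj₂ ∘ int)
      (tightℚ-scale (matrix P) (rhs P) (rhs (dilate (suc k) P)) (ℤ.+ suc k / 1) (fromℕ-nonNeg (suc k)) (λ _ → refl) x∈)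

  integer : ∀ k → (∀ S → FaceInteger S (suc k)) → IsIntegerℚ (dilate (suc k) P)
  integer k int S (x , x∈) =
    let u , 0<u , ku≡1 = posInverse (positive⁻¹ (ℤ.+ suc k / 1) {{normalize-pos (suc k) 1}}) in
    int S (_ , tightℚ-scale (matrix P) (rhs (dilate (suc k) P)) (rhs P) u (<⇒≤ 0<u)
      (λ i → trans (sym (*-assoc u (ℤ.+ suc k / 1) (rhs P i)))
        (trans (cong (_* rhs P i) (trans (*-comm u (ℤ.+ suc k / 1)) ku≡1)) (*-identityˡ (rhs P i)))) x∈)

-- From box-integrality to equimodularity

-- Since the columns in `C` are invertible, they can cancel column j. If j lies in `C`, the unit
-- vector is 0 off `C` and the statement still holds.
rationalKernel : ∀ {r n} (M : Matrix r n) (C : Selection r n) → det (selectColumns M C) ≢ 0ℚ → ∀ j →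
                 ∃ λ x → InKernel M x × (∀ l → (∀ k → index C k ≢ l) → x l ≡ identity j l)
rationalKernel {n = n} M C δ≢0 j = fromSolution
  (injective⇒surjective (selectColumns M C) (det≢0⇒injective (selectColumns M C) δ≢0) (λ i → - M i j))
  where
  fromSolution : (∃ λ y → IsCombination y (column (selectColumns M C)) (λ i → - M i j)) →
                 ∃ λ x → InKernel M x × (∀ l → (∀ k → index C k ≢ l) → x l ≡ identity j l)
  fromSolution (y , -Mj≗) = x , x∈ker , λ l l∉C →
    trans (cong (_+ 1ℚ * identity j l) (extend-off C y l∉C)) (trans (+-identityˡ _) (*-identityˡ (identity j l)))
    where
    open ≡-Reasoning
    x : Vector ℚ n
    x l = extend C y l + 1ℚ * identity j l
    cancel : ∀ p → - p + 1ℚ * p ≡ 0ℚ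
    cancel = solve 1 (λ p → :- p :+ con 1ℚ :* p := con 0ℚ) refl
    x∈ker : InKernel M x
    x∈ker i = begin
      M i ⋆ x                                          ≡⟨ ⋆-axpyʳ (M i) (extend C y) 1ℚ (identity j) ⟩
      M i ⋆ extend C y + 1ℚ * M i ⋆ identity j         ≡⟨ cong₂ (λ p q → p + 1ℚ * q)
        (trans (⋆-extend C (M i) y) (trans (⋆-comm (M i ∘ index C) y) (sym (-Mj≗ i)))) (⋆-identity (M i) j) ⟩
      - M i j + 1ℚ * M i j                             ≡⟨ cancel (M i j) ⟩
      0ℚ                                               ∎

-- Subtracting the j-th unit vector from z leaves an integer vector supported on `C`, which `M` maps
-- to minus column j.
kernel⇒combination : ∀ {r n} (M : Matrix r n) (C : Selection r n) j (z : Vector ℤ n) → InKernel M (λ l → z l / 1) →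
                     (∀ l → (∀ k → index C k ≢ l) → z l / 1 ≡ identity j l) →
                     ∃ λ w → (∀ k → IsInt (w k)) × IsCombination w (column (selectColumns M C)) (column M j)
kernel⇒combination {n = n} M C j z z∈ker z-off =
  (λ k → - v (index C k)) ,
  (λ k → isInt-neg (isInt-+ (z (index C k) , refl) (isInt-* (isInt-neg (ℤ.+ 1 , refl)) (isInt-identity j (index C k))))) ,
  λ i → begin
    M i j                                      ≡⟨ arith (M i ⋆ z/1) (M i j) ⟩
    M i ⋆ z/1 - (M i ⋆ z/1 + - 1ℚ * M i j)     ≡⟨ cong₂ _-_ (z∈ker i) (sym (v-row i)) ⟩
    0ℚ - (M i ∘ index C) ⋆ (v ∘ index C)       ≡⟨ +-identityˡ _ ⟩
    - (M i ∘ index C) ⋆ (v ∘ index C)          ≡⟨ cong -_ (⋆-comm (M i ∘ index C) (v ∘ index C)) ⟩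
    - (v ∘ index C) ⋆ (M i ∘ index C)          ≡⟨ neg-⋆ (v ∘ index C) (M i ∘ index C) ⟨
    (λ k → - v (index C k)) ⋆ (M i ∘ index C)  ∎
  where
  open ≡-Reasoning
  arith : ∀ p q → q ≡ p - (p + - 1ℚ * q)
  arith = solve 2 (λ p q → q := p :- (p :+ :- con 1ℚ :* q)) refl
  cancel : ∀ p → p + - 1ℚ * p ≡ 0ℚ
  cancel = solve 1 (λ p → p :+ :- con 1ℚ :* p := con 0ℚ) refl

  z/1 v : Vector ℚ n
  z/1 l = z l / 1
  v l = z/1 l + - 1ℚ * identity j l

  v≗extend : ∀ l → v l ≡ extend C (v ∘ index C) l
  v≗extend l = case Fin.any? (λ k → index C k Fin.≟ l) of λ
    { (yes (k , refl)) → sym (extend-on C (v ∘ index C) k)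
    ; (no l∉C) → let off = λ k k≡l → l∉C (k , k≡l) in
        trans (cong (_+ - 1ℚ * identity j l) (z-off l off))
              (trans (cancel (identity j l)) (sym (extend-off C (v ∘ index C) off))) }

  v-row : ∀ i → (M i ∘ index C) ⋆ (v ∘ index C) ≡ M i ⋆ z/1 + - 1ℚ * M i j
  v-row i = begin
    (M i ∘ index C) ⋆ (v ∘ index C)         ≡⟨ ⋆-extend C (M i) (v ∘ index C) ⟨
    M i ⋆ extend C (v ∘ index C)            ≡⟨ ⋆-cong {a = M i} (λ _ → refl) v≗extend ⟨
    M i ⋆ v                                 ≡⟨ ⋆-axpyʳ (M i) z/1 (- 1ℚ) (identity j) ⟩
    M i ⋆ z/1 + - 1ℚ * M i ⋆ identity j     ≡⟨ cong (λ t → M i ⋆ z/1 + - 1ℚ * t) (⋆-identity (M i) j) ⟩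
    M i ⋆ z/1 + - 1ℚ * M i j                ∎

module _ {r m n} (A : Matrix m n) (R : Selection r m) where

  private
    M : Matrix r n
    M = selectRows A R

    selected? : ∀ i → Dec (∃ λ k → index R k ≡ i)
    selected? i = Fin.any? λ k → index R k Fin.≟ i

    bound : ∀ {i} → Dec (∃ λ k → index R k ≡ i) → ℚ
    bound (yes _) = 0ℚ
    bound (no _)  = 1ℚ

  -- The origin lies in the relative interior of the face where the rows in R are tight, so after a large dilation
  -- only these rows constrain a given vector of ker M.
  faceRhs : Vector ℚ m
  faceRhs i = bound (selected? i)

  faceRhs-selected : ∀ k → faceRhs (index R k) ≡ 0ℚ
  faceRhs-selected k = bound-yes (selected? (index R k))
    where
    bound-yes : (d : Dec (∃ λ k′ → index R k′ ≡ index R k)) → bound d ≡ 0ℚ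
    bound-yes (yes _) = refl
    bound-yes (no ¬p) = contradiction (k , refl) ¬p

  -- `k₀` is a parameter because a suitable dilation is only known to exist up to double negation.
  module _ (boxInteger : (k : ℕ) .{{_ : ℕ.NonZero k}} → IsIntegerℚ (dilate k (polyhedron A faceRhs)) →
                         ∀ ℓ u → IsIntegerℚ (dilate k (polyhedron A faceRhs) ⊓ᴾ box ℓ u))
           (k₀ : ℕ) (dilation : ∀ K → IsIntegerℚ (dilate (suc K ℕ.* suc k₀) (polyhedron A faceRhs)))
    where

    -- The box pins the coordinates off `C` to those of x. On `C`, where x may be fractional, it
    -- only encloses x.
    integerKernel : ∀ (C : Selection r n) x → InKernel M x → (∀ l → (∀ k → index C k ≢ l) → IsInt (x l)) →
                    ∃ λ (z : Vector ℤ n) → InKernel M (λ l → z l / 1) × (∀ l → (∀ k → index C k ≢ l) → z l / 1 ≡ x l)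
    integerKernel C x x∈ker x-int = z , z∈ker , λ l l∉C → ≤-antisym
      (≤-trans (subst₂ _≤_ (⋆-upper A b ℓ u l z/1) (rhs-upper A b ℓ u l) (proj₁ z∈ (upper A b ℓ u l)))
               (≤-reflexive (sym (proj₂ (proj₂ (proj₂ (bracketed l)) l∉C)))))
      (≤-trans (≤-reflexive (proj₁ (proj₂ (proj₂ (bracketed l)) l∉C)))
               (subst₂ _≤_ (neg-involutive (ℓ l / 1)) (neg-involutive (z l / 1))
                 (neg-antimono-≤ (subst₂ _≤_ (⋆-lower A b ℓ u l z/1) (rhs-lower A b ℓ u l) (proj₁ z∈ (lower A b ℓ u l))))))
      where
      Bracket : Fin n → ℤ → ℤ → Set
      Bracket l a b = a / 1 ≤ x l × x l ≤ b / 1 × ((∀ k → index C k ≢ l) → x l ≡ a / 1 × x l ≡ b / 1)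

      bracket : ∀ l → ∃₂ (Bracket l)
      bracket l with Fin.any? (λ k → index C k Fin.≟ l)
      ... | yes (k , k≡l) = let a , -x≤a = archimedean (- x l) ; b , x≤b = archimedean (x l) in
        ℤ.- (ℤ.+ a) , ℤ.+ b ,
        subst₂ _≤_ (/1-homo-neg (ℤ.+ a)) (neg-involutive (x l)) (neg-antimono-≤ -x≤a) , x≤b ,
        λ l∉C → contradiction k≡l (l∉C k)
      ... | no l∉C = let z , x≡z = x-int l (λ k k≡l → l∉C (k , k≡l)) in
        z , z , ≤-reflexive (sym x≡z) , ≤-reflexive x≡z , λ _ → x≡z , x≡z

      ℓ u : Vector ℤ n
      ℓ l = proj₁ (bracket l)
      u l = proj₁ (proj₂ (bracket l))

      bracketed : ∀ l → Bracket l (ℓ l) (u l)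
      bracketed l = proj₂ (proj₂ (bracket l))

      K : ℕ
      K = proj₁ (upperBound (λ i → A i ⋆ x))

      k : ℕ
      -- A multiple of `suc k₀`, so the dilation is integer, and at least `K`, so x satisfies the
      -- rows outside `R`; `suc K` keeps it positive.
      k = suc K ℕ.* suc k₀

      b : Vector ℚ m
      b i = ℤ.+ k / 1 * faceRhs i

      b-selected : ∀ i → b (index R i) ≡ 0ℚ
      b-selected i = trans (cong (ℤ.+ k / 1 *_) (faceRhs-selected i)) (*-zeroʳ (ℤ.+ k / 1))

      A⋆x≤b : ∀ i (d : Dec (∃ λ k′ → index R k′ ≡ i)) → A i ⋆ x ≤ ℤ.+ k / 1 * bound d
      A⋆x≤b i (yes (k′ , refl)) = ≤-reflexive (trans (x∈ker k′) (sym (*-zeroʳ (ℤ.+ k / 1))))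
      A⋆x≤b i (no _) = ≤-trans (proj₂ (upperBound (λ i → A i ⋆ x)) i)
        (≤-trans (fromℕ-mono-≤ (ℕ.≤-trans (ℕ.n≤1+n K) (ℕ.m≤m*n (suc K) (suc k₀))))
                 (≤-reflexive (sym (*-identityʳ (ℤ.+ k / 1)))))

      S? : Decidable (λ i → ∃ λ k′ → fromA A b ℓ u (index R k′) ≡ i)
      S? i = Fin.any? λ k′ → fromA A b ℓ u (index R k′) Fin.≟ i

      S : Subset (rows (boxed A b ℓ u))
      S = toSubset S?

      x∈ : tightℚ (boxed A b ℓ u) S x
      x∈ = rows-elim A b ℓ u (λ i → matrix (boxed A b ℓ u) i ⋆ x ≤ rhs (boxed A b ℓ u) i)
             (λ i → subst₂ _≤_ (sym (⋆-fromA A b ℓ u i x)) (sym (rhs-fromA A b ℓ u i)) (A⋆x≤b i (selected? i)))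
             (λ l → subst₂ _≤_ (sym (⋆-upper A b ℓ u l x)) (sym (rhs-upper A b ℓ u l)) (proj₁ (proj₂ (bracketed l))))
             (λ l → subst₂ _≤_ (sym (⋆-lower A b ℓ u l x)) (sym (rhs-lower A b ℓ u l))
                      (neg-antimono-≤ (proj₁ (bracketed l)))) ,
           λ i i∈S → tight-at i (∈-toSubset⁻ S? i∈S)
        where
        tight-at : ∀ i → (∃ λ k′ → fromA A b ℓ u (index R k′) ≡ i) → matrix (boxed A b ℓ u) i ⋆ x ≡ rhs (boxed A b ℓ u) i
        tight-at _ (k′ , refl) = trans (⋆-fromA A b ℓ u (index R k′) x)
          (trans (x∈ker k′) (sym (trans (rhs-fromA A b ℓ u (index R k′)) (b-selected k′))))

      integerPoint : ∃ λ (z : Vector ℤ n) → tightℚ (boxed A b ℓ u) S (λ l → z l / 1)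
      integerPoint = boxInteger k (dilation K) ℓ u S (x , x∈)

      z : Vector ℤ n
      z = proj₁ integerPoint

      z/1 : Vector ℚ n
      z/1 l = z l / 1

      z∈ : tightℚ (boxed A b ℓ u) S z/1
      z∈ = proj₂ integerPoint

      z∈ker : InKernel M z/1
      z∈ker i = trans (sym (⋆-fromA A b ℓ u (index R i) z/1))
        (trans (proj₂ z∈ (fromA A b ℓ u (index R i)) (∈-toSubset⁺ S? (i , refl)))
          (trans (rhs-fromA A b ℓ u (index R i)) (b-selected i)))

    integerCombination : ∀ (C : Selection r n) → det (selectColumns M C) ≢ 0ℚ → ∀ j →
      ∃ λ w → (∀ k → IsInt (w k)) × IsCombination w (column (selectColumns M C)) (column M j)
    integerCombination C δ≢0 j =
      let x , x∈ker , x-off = rationalKernel M C δ≢0 j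
          z , z∈ker , z-off = integerKernel C x x∈ker (λ l l∉C → subst IsInt (sym (x-off l l∉C)) (isInt-identity j l))
      in kernel⇒combination M C j z z∈ker (λ l l∉C → trans (z-off l l∉C) (x-off l l∉C))

    -- Expanding the columns in `D` integrally leaves determinants of lists of columns from `C`,
    -- each of them 0 or ±δ.
    det-multiple : ∀ (C D : Selection r n) → det (selectColumns M C) ≢ 0ℚ →
                   det (selectColumns M D) ∈ℤ· det (selectColumns M C)
    det-multiple C D δ≢0 = subst (_∈ℤ· δ)
      (trans (colForm-column (selectColumns M D) (allFin r)) (sym (det≡form-allFin (selectColumns M D))))
      (expand IsInt (_∈ℤ· δ) ∈ℤ·-zero ∈ℤ·-+ ∈ℤ·-* colForm (multilinear-form id) (column (selectColumns M C)) minors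
        (All.map⁺ (All.universal (λ k → integerCombination C δ≢0 (index D k)) (allFin r))))
      where
      δ = det (selectColumns M C)
      minors : ∀ f → colForm (map (column (selectColumns M C)) f) ∈ℤ· δ
      minors f = subst (_∈ℤ· δ) (sym (colForm-column (selectColumns M C) f))
        (case alternating-allFin (form (selectColumns M C)) (alternating-form (selectColumns M C)) f of λ
          { (inj₁ eq) → subst (_∈ℤ· δ) (sym eq) ∈ℤ·-zero
          ; (inj₂ eq) → ∈ℤ·-± (subst (form (selectColumns M C) f ≡±_) (sym (det≡form-allFin (selectColumns M C))) eq) })

-- The equivalence

≡±⇒∣∣ : ∀ {p q} → p ≡± q → ∣ p ∣ ≡ ∣ q ∣
≡±⇒∣∣ {q = q} (inj₁ refl) = refl
≡±⇒∣∣ {q = q} (inj₂ refl) = ∣-p∣≡∣p∣ q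

-- The two integer factors have product 1 after cancelling q, so both are units of ℤ.
mutual-multiples : ∀ {p q} → q ≢ 0ℚ → p ∈ℤ· q → q ∈ℤ· p → ∣ p ∣ ≡ ∣ q ∣
mutual-multiples {p} {q} q≢0 (c , c-int , p≡cq) (d , d-int , q≡dp) =
  ≡±⇒∣∣ (subst (_≡± q) (sym p≡cq) (scale (unit⇒±1 c-int d-int cd≡1)))
  where
  scale : ∀ {c} → c ≡± 1ℚ → c * q ≡± q
  scale (inj₁ refl) = inj₁ (*-identityˡ q)
  scale (inj₂ refl) = inj₂ (trans (sym (neg-distribˡ-* 1ℚ q)) (cong -_ (*-identityˡ q)))
  arith : ∀ c d q → q * (c * d - 1ℚ) ≡ d * (c * q) - q
  arith = solve 3 (λ c d q → q :* (c :* d :- con 1ℚ) := d :* (c :* q) :- q) refl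
  arith′ : ∀ a → a ≡ a - 1ℚ + 1ℚ
  arith′ = solve 1 (λ a → a := a :- con 1ℚ :+ con 1ℚ) refl
  cd≡1 : c * d ≡ 1ℚ
  cd≡1 = trans (arith′ (c * d)) (cong (_+ 1ℚ) (*-cancel-0 q≢0 (trans (arith c d q)
    (trans (cong (λ t → d * t - q) (sym p≡cq)) (trans (cong (_- q) (sym q≡dp)) (+-inverseʳ q))))))

theorem4p5 : (m n : ℕ) (A : Matrix m n) → TotallyEquimodular A ⇔ ((b : Vector ℚ m) → IsPrincipallyBoxInteger (polyhedron A b))
theorem4p5 m n A = mk⇔ equimodular⇒boxInteger boxInteger⇒equimodular
  where
  equimodular⇒boxInteger : TotallyEquimodular A → (b : Vector ℚ m) → IsPrincipallyBoxInteger (polyhedron A b)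
  -- Total equimodularity concerns `A` alone, and dilation changes only the right-hand side.
  equimodular⇒boxInteger te b k int ℓ u = isIntegerℚ⇒ (dilate k (polyhedron A b) ⊓ᴾ box ℓ u)
    (boxed-integer A (rhs (dilate k (polyhedron A b))) ℓ u te (isInteger⇒ℚ (dilate k (polyhedron A b)) int))

  boxInteger⇒equimodular : ((b : Vector ℚ m) → IsPrincipallyBoxInteger (polyhedron A b)) → TotallyEquimodular A
  boxInteger⇒equimodular principal {r} R ind = ind , λ C D δC≢0 δD≢0 → decidable-stable (_ ≟ _)
    (¬¬-map (λ (k₀ , dilation) →
        mutual-multiples δD≢0 (det-multiple A R boxInteger k₀ dilation D C δD≢0)
                              (det-multiple A R boxInteger k₀ dilation C D δC≢0))
      (integerDilation P))
    where
    P : Polyhedron n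
    P = polyhedron A (faceRhs A R)

    boxInteger : (k : ℕ) .{{_ : ℕ.NonZero k}} → IsIntegerℚ (dilate k P) →
                 ∀ ℓ u → IsIntegerℚ (dilate k P ⊓ᴾ box ℓ u)
    boxInteger k int ℓ u = isInteger⇒ℚ (dilate k P ⊓ᴾ box ℓ u)
      (principal (faceRhs A R) k (isIntegerℚ⇒ (dilate k P) int) ℓ u)
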